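{- Let ${\sf LocFin}_{\sf G}$ be the following formula about a countable graph $(V,E)$: $$\forall a\in V\ \exists k\ \ |\{b\in V:(a,b)\in E\}|\le k.$$ Then ${\sf LocFin}_{\sf G}$ is $\forall\forall^\infty\forall$-dicomplete.
   Context: Quantifiers range over $\omega$. $\exists^\infty n\,\varphi(n)$ means $\forall m\exists n\ge m\,\varphi(n)$ and $\forall^\infty n\,\varphi(n)$ means $\exists m\forall n\ge m\,\varphi(n)$. A quantifier-pattern is a finite string $\bar{\mathsf Q}=\mathsf Q_0\dots\mathsf Q_\ell$ over $\{\exists,\forall,\exists^\infty,\forall^\infty\}$. A $\bar{\mathsf Q}$-formula is $\varphi(\bar x)\equiv\mathsf Q_0n_0\dots\mathsf Q_\ell n_\ell\,\theta(n_0,\dots,n_\ell,\bar x)$ with $\theta$ a bounded formula. The instance $\bar x$ is a tuple of natural numbers and/or total computable functions (computable elements of $\omega^\omega$). Spaces such as $\omega\times\omega^\omega$, $(\omega^\omega)^\omega$, $\omega^{\omega\times\omega}$ are identified with $\omega^\omega$ by computable pairing. Witnesses: for $\alpha\in\omega^\omega$, $\alpha\Vdash\varphi(\bar x)$ ("$\alpha$ is a witness for $\varphi(\bar x)$") is defined by: $\alpha\Vdash\theta(\bar x)$ iff $\alpha=\bar x$ and $\theta(\bar x)$, for bounded $\theta$; $\langle t,\alpha\rangle\Vdash\exists n\varphi(n,\bar x)$ iff $\alpha\Vdash\varphi(t,\bar x)$; $\alpha\Vdash\forall n\varphi(n,\bar x)$ iff $\alpha(n)\Vdash\varphi(n,\bar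 x)$ for all $n$; $\langle t,\alpha\rangle\Vdash\forall^\infty n\varphi(n,\bar x)$ iff $\alpha(n)\Vdash\varphi(n,\bar x)$ for all $n\ge t$; $\alpha\Vdash\exists^\infty n\varphi(n,\bar x)$ iff for all $n$, writing $\alpha(n)=\langle k,\beta\rangle$, $k\ge n$ and $\beta\Vdash\varphi(k,\bar x)$. Reducibility: $\varphi\le_{\sf m}\psi$ if there are computable functions $\eta,r_-,r_+$ (type-two computable functionals, possibly partial but defined wherever required) such that for every instance $\bar x$: $\varphi(\bar x)$ is true iff $\psi(\eta(\bar x))$ is true; $\alpha\Vdash\varphi(\bar x)$ implies $r_-(\alpha,\bar x)\Vdash\psi(\eta(\bar x))$; $\alpha\Vdash\psi(\eta(\bar x))$ implies $r_+(\alpha,\bar x)\Vdash\varphi(\bar x)$ ($\alpha\in\omega^\omega$ arbitrary). The dual $\varphi^{\sf d}$ of $\mathsf Q_0n_0\dots\mathsf Q_\ell n_\ell\,\theta$ is $\mathsf Q_0^{\sf d}n_0\dots\mathsf Q_\ell^{\sf d}n_\ell\,\neg\theta$, where $\exists^{\sf d}=\forall$, $\forall^{\sf d}=\exists$, $(\exists^\infty)^{\sf d}=\forall^\infty$, $(\forall^\infty)^{\sf d}=\exists^\infty$. $\varphi\le_{\sf dm}\psi$ if $\varphi\le_{\sf m}\psi$ and $\varphi^{\sf d}\le_{\sf m}\psi^{\sf d}$ via a common $\eta$ (the $r_\pm$ may differ). $\varphi$ is strictly $\bar{\mathsf Q}$-dicomplete if it is a $\bar{\mathsf Q}$-formula and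 $\psi\le_{\sf dm}\varphi$ for every $\bar{\mathsf Q}$-formula $\psi$; it is $\bar{\mathsf Q}$-dicomplete if it is $\equiv_{\sf dm}$-equivalent to a strictly $\bar{\mathsf Q}$-dicomplete formula (one such is $\mathsf Q_0n_0\dots\mathsf Q_\ell n_\ell.\ x(n_0,\dots,n_\ell)=0$). Structures: a countable binary relation $(X,R)$, $X\subseteq\omega$, $R\subseteq X^2$, is coded by the pair of characteristic functions of $X$ and $R$, and is identified with its code. Graphs are undirected. Instances of ${\sf LocFin}_{\sf G}$ are (computable) codes of graphs; reductions from it need only work on such codes and reductions to it must output such codes. Restricted quantifiers mean $\forall a(a\in V\to\cdots)$ etc., with decidable conditions moved into the innermost bounded part. For a set $A$, $|A|\le k$ abbreviates $\forall c_0,\dots,c_k\in A\ \exists i,j\le k\,(i\ne j\wedge c_i=c_j)$, where the block $\forall c_0,\dots,c_k$ is one universal quantifier over coded tuples. -}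

module Defs where

open import Data.Nat using (ℕ; zero; suc; _+_; _*_; _≤_; _<_)
open import Data.Nat.Properties using (+-suc; +-identityʳ)
open import Data.Fin using (Fin; zero; suc)
open import Data.Fin.Patterns
open import Data.List using (List; []; _∷_; map)
open import Data.Product using (_×_; _,_; proj₁; proj₂; ∃; ∃-syntax; Σ-syntax)
open import Data.Sum using (_⊎_)
open import Data.Unit using (⊤)
open import Data.Vec using (Vec; []; _∷_; lookup)
open import Data.Vec.Relation.Unary.All using (All)
open import Function using (_∘_; _⇔_)
open import Relation.Binary.PropositionalEquality using (_≡_; _≗_; refl; sym; trans; cong)
open import Relation.Nullary using (¬_)

triangle : ℕ → ℕ
triangle zero    = zero
triangle (suc n) = suc n + triangle n

-- Cantor's pairing.
⟨_,_⟩ : ℕ → ℕ → ℕ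
⟨ m , n ⟩ = n + triangle (m + n)

private
  next : ℕ × ℕ → ℕ × ℕ
  next (suc m , n) = m , suc n
  next (zero  , n) = suc n , zero

unpair : ℕ → ℕ × ℕ
unpair zero    = zero , zero
unpair (suc c) = next (unpair c)

unpair-⟨,⟩ : ∀ m n → unpair ⟨ m , n ⟩ ≡ (m , n)
unpair-⟨,⟩ m n = go (m + n) m n refl
  where
  go : ∀ s m n → m + n ≡ s → unpair (n + triangle s) ≡ (m , n)
  go s m (suc n) eq =
    cong next (go s (suc m) n (trans (sym (+-suc m n)) eq))
  go zero    zero    zero eq = refl
  go (suc s) (suc m) zero eq with trans (sym (+-identityʳ (suc m))) eq
  ... | refl = cong next (go s zero s refl)

⟨,⟩-unpair : ∀ c → ⟨ proj₁ (unpair c) , proj₂ (unpair c) ⟩ ≡ c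
⟨,⟩-unpair zero = refl
⟨,⟩-unpair (suc c) with unpair c | ⟨,⟩-unpair c
... | suc m , n | eq rewrite +-suc m n = cong suc eq
... | zero  , n | eq rewrite +-identityʳ n = cong suc eq

-- Tuples of any length k + 1 are coded by iterated pairing: `c at i` is the
-- i-th entry of c = ⟨ c₀ , ⟨ c₁ , ⟨ c₂ , … ⟩ ⟩ ⟩.  Every number codes a
-- (k + 1)-tuple, and every (k + 1)-tuple has a code.
_at_ : ℕ → ℕ → ℕ
c at zero  = proj₁ (unpair c)
c at suc i = proj₂ (unpair c) at i

Baire : Set
Baire = ℕ → ℕ

-- ω × ω^ω ≅ ω^ω: the number t and the function β coded by α = ⟨ t , β ⟩
-- are head α and tail α.
head : Baire → ℕ
head α = α 0

tail : Baire → Baire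
tail α = α ∘ suc

cons : ℕ → Baire → Baire
cons t β zero    = t
cons t β (suc i) = β i

-- (ω^ω)^ω ≅ ω^ω
slice : Baire → ℕ → Baire
slice α n i = α ⟨ n , i ⟩

-- ω^ω × ω^ω ≅ ω^ω, by f 0 , g 0 , f 1 , g 1 , …
_⊕_ : Baire → Baire → Baire
(f ⊕ g) zero    = f zero
(f ⊕ g) (suc n) = (g ⊕ tail f) n

Tuple : ℕ → ℕ → Set
Tuple k m = Vec ℕ k × Vec Baire m

join : ∀ {m} → Vec Baire m → Baire
join []           = λ _ → 0
join (f ∷ [])     = f
join (f ∷ g ∷ fs) = f ⊕ join (g ∷ fs)

code : ∀ {k m} → Tuple k m → Baire
code ([]     , fs) = join fs
code (n ∷ ns , fs) = cons n (code (ns , fs))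

data Rec (o : ℕ) : ℕ → Set where
  zero : ∀ {n} → Rec o n
  suc  : Rec o 1
  proj : ∀ {n} → Fin n → Rec o n
  call : Fin o → Rec o 1
  comp : ∀ {n j} → Rec o j → Vec (Rec o n) j → Rec o n
  prec : ∀ {n} → Rec o n → Rec o (2 + n) → Rec o (suc n)
  mu   : ∀ {n} → Rec o (suc n) → Rec o n

mutual
  -- Γ ⊢ p · xs ⇓ v: with oracles Γ, program p on inputs xs halts with value v.
  data _⊢_·_⇓_ {o} (Γ : Vec Baire o) : ∀ {n} → Rec o n → Vec ℕ n → ℕ → Set where
    zero⇓ : ∀ {n} {xs : Vec ℕ n} → Γ ⊢ zero · xs ⇓ 0
    suc⇓  : ∀ {x} → Γ ⊢ suc · (x ∷ []) ⇓ suc x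
    proj⇓ : ∀ {n} {xs : Vec ℕ n} {i} → Γ ⊢ proj i · xs ⇓ lookup xs i
    call⇓ : ∀ {x i} → Γ ⊢ call i · (x ∷ []) ⇓ lookup Γ i x
    comp⇓ : ∀ {n j} {xs : Vec ℕ n} {p : Rec o j} {qs ys v} →
            Γ ⊢ qs ·* xs ⇓ ys → Γ ⊢ p · ys ⇓ v → Γ ⊢ comp p qs · xs ⇓ v
    prec-zero⇓ : ∀ {n} {xs : Vec ℕ n} {p q v} →
            Γ ⊢ p · xs ⇓ v → Γ ⊢ prec p q · (0 ∷ xs) ⇓ v
    prec-suc⇓ : ∀ {n} {xs : Vec ℕ n} {p q x u v} →
            Γ ⊢ prec p q · (x ∷ xs) ⇓ u → Γ ⊢ q · (x ∷ u ∷ xs) ⇓ v →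
            Γ ⊢ prec p q · (suc x ∷ xs) ⇓ v
    mu⇓   : ∀ {n} {xs : Vec ℕ n} {p y} →
            Γ ⊢ p · (y ∷ xs) ⇓ 0 →
            (∀ z → z < y → ∃[ u ] Γ ⊢ p · (z ∷ xs) ⇓ suc u) →
            Γ ⊢ mu p · xs ⇓ y

  data _⊢_·*_⇓_ {o} (Γ : Vec Baire o) {n} :
         ∀ {j} → Vec (Rec o n) j → Vec ℕ n → Vec ℕ j → Set where
    []  : ∀ {xs} → Γ ⊢ [] ·* xs ⇓ []
    _∷_ : ∀ {j xs q y} {qs : Vec (Rec o n) j} {ys} →
          Γ ⊢ q · xs ⇓ y → Γ ⊢ qs ·* xs ⇓ ys → Γ ⊢ (q ∷ qs) ·* xs ⇓ (y ∷ ys)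

-- A program with o oracles and one input is a partial functional from
-- (ω^ω)^o to ω^ω; this says it is defined at Γ with value β.
_[_]↦_ : ∀ {o} → Rec o 1 → Vec Baire o → Baire → Set
p [ Γ ]↦ β = ∀ n → Γ ⊢ p · (n ∷ []) ⇓ β n

Computable : Baire → Set
Computable f = ∃[ p ] (p [ [] ]↦ f)

IsInstance : ∀ {k m} → Tuple k m → Set
IsInstance (ns , fs) = All Computable fs

-- Bounded arithmetical formulas in k number variables (de Bruijn indices) and m
-- function variables.  The symbols for pairing and tuple entries have bounded
-- arithmetical definitions; they make x (n₀ , … , n_ℓ) = 0 a formula for x on
-- coded tuples.
data Term (k m : ℕ) : Set where
  var       : Fin k → Term k m
  lit       : ℕ → Term k m
  _+ᵗ_ _*ᵗ_ : Term k m → Term k m → Term k m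
  ⟨_,_⟩ᵗ    : Term k m → Term k m → Term k m
  _atᵗ_     : Term k m → Term k m → Term k m
  fun       : Fin m → Term k m → Term k m

data Bounded (k m : ℕ) : Set where
  _≐_ _≼_      : Term k m → Term k m → Bounded k m
  neg          : Bounded k m → Bounded k m
  _∧_ _∨_ _⇒_  : Bounded k m → Bounded k m → Bounded k m
  all≤ ex≤     : Term k m → Bounded (suc k) m → Bounded k m

infix  8 _≐_ _≼_
infixr 7 _∧_
infixr 6 _∨_
infixr 5 _⇒_

⟦_⟧ᵗ : ∀ {k m} → Term k m → Tuple k m → ℕ
⟦ var i      ⟧ᵗ (ns , fs) = lookup ns i
⟦ lit c      ⟧ᵗ x         = c
⟦ s +ᵗ t     ⟧ᵗ x         = ⟦ s ⟧ᵗ x + ⟦ t ⟧ᵗ x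
⟦ s *ᵗ t     ⟧ᵗ x         = ⟦ s ⟧ᵗ x * ⟦ t ⟧ᵗ x
⟦ ⟨ s , t ⟩ᵗ ⟧ᵗ x         = ⟨ ⟦ s ⟧ᵗ x , ⟦ t ⟧ᵗ x ⟩
⟦ s atᵗ t    ⟧ᵗ x         = ⟦ s ⟧ᵗ x at ⟦ t ⟧ᵗ x
⟦ fun i t    ⟧ᵗ (ns , fs) = lookup fs i (⟦ t ⟧ᵗ (ns , fs))

infixr 5 _◂_
_◂_ : ∀ {k m} → ℕ → Tuple k m → Tuple (suc k) m
n ◂ (ns , fs) = n ∷ ns , fs

⟦_⟧ᵇ : ∀ {k m} → Bounded k m → Tuple k m → Set
⟦ s ≐ t    ⟧ᵇ x = ⟦ s ⟧ᵗ x ≡ ⟦ t ⟧ᵗ x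
⟦ s ≼ t    ⟧ᵇ x = ⟦ s ⟧ᵗ x ≤ ⟦ t ⟧ᵗ x
⟦ neg θ    ⟧ᵇ x = ¬ ⟦ θ ⟧ᵇ x
⟦ θ ∧ χ    ⟧ᵇ x = ⟦ θ ⟧ᵇ x × ⟦ χ ⟧ᵇ x
⟦ θ ∨ χ    ⟧ᵇ x = ⟦ θ ⟧ᵇ x ⊎ ⟦ χ ⟧ᵇ x
⟦ θ ⇒ χ    ⟧ᵇ x = ⟦ θ ⟧ᵇ x → ⟦ χ ⟧ᵇ x
⟦ all≤ t θ ⟧ᵇ x = ∀ i → i ≤ ⟦ t ⟧ᵗ x → ⟦ θ ⟧ᵇ (i ◂ x)
⟦ ex≤ t θ  ⟧ᵇ x = ∃[ i ] (i ≤ ⟦ t ⟧ᵗ x × ⟦ θ ⟧ᵇ (i ◂ x))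

data Quantifier : Set where
  `∃ `∀ `∃∞ `∀∞ : Quantifier

Pattern : Set
Pattern = List Quantifier

-- Formula Q̄ k m: the Q̄-formulas about k numbers and m functions.  Each
-- quantifier binds number variable 0 of its scope, so the matrix of
-- Q₀ n₀ … Q_ℓ n_ℓ is evaluated at the tuple (n_ℓ , … , n₀ , x).
data Formula : Pattern → ℕ → ℕ → Set where
  matrix : ∀ {k m} → Bounded k m → Formula [] k m
  quant  : ∀ {Qs k m} (Q : Quantifier) → Formula Qs (suc k) m → Formula (Q ∷ Qs) k m

dualQ : Quantifier → Quantifier
dualQ `∃  = `∀
dualQ `∀  = `∃
dualQ `∃∞ = `∀∞
dualQ `∀∞ = `∃∞

dual : ∀ {Qs k m} → Formula Qs k m → Formula (map dualQ Qs) k m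
dual (matrix θ)  = matrix (neg θ)
dual (quant Q φ) = quant (dualQ Q) (dual φ)

True : ∀ {Qs k m} → Formula Qs k m → Tuple k m → Set
True (matrix θ)    x = ⟦ θ ⟧ᵇ x
True (quant `∃  φ) x = ∃[ n ] True φ (n ◂ x)
True (quant `∀  φ) x = ∀ n → True φ (n ◂ x)
True (quant `∃∞ φ) x = ∀ m → ∃[ n ] (m ≤ n × True φ (n ◂ x))
True (quant `∀∞ φ) x = ∃[ m ] (∀ n → m ≤ n → True φ (n ◂ x))

-- The bounded clause refers to the tuple including the values of the quantified
-- variables; equality in ω^ω is pointwise.
_⊩_⟪_⟫ : ∀ {Qs k m} → Baire → Formula Qs k m → Tuple k m → Set
α ⊩ matrix θ    ⟪ x ⟫ = α ≗ code x × ⟦ θ ⟧ᵇ x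
α ⊩ quant `∃  φ ⟪ x ⟫ = tail α ⊩ φ ⟪ head α ◂ x ⟫
α ⊩ quant `∀  φ ⟪ x ⟫ = ∀ n → slice α n ⊩ φ ⟪ n ◂ x ⟫
α ⊩ quant `∃∞ φ ⟪ x ⟫ = ∀ n → let k = head (slice α n); β = tail (slice α n) in
                        n ≤ k × β ⊩ φ ⟪ k ◂ x ⟫
α ⊩ quant `∀∞ φ ⟪ x ⟫ = ∀ n → head α ≤ n → slice (tail α) n ⊩ φ ⟪ n ◂ x ⟫

-- A formula together with the set of tuples it is a statement about.
record Problem : Set₁ where
  field
    {quants} : Pattern
    {nums}     : ℕ
    {funs}     : ℕ
    formula    : Formula quants nums funs
    Domain     : Tuple nums funs → Set

open Problem

dualP : Problem → Problem
dualP P = record { formula = dual (formula P) ; Domain = Domain P }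

everywhere : ∀ {Qs k m} → Formula Qs k m → Problem
everywhere φ = record { formula = φ ; Domain = λ _ → ⊤ }

-- The functions in x and y are computable; the witnesses α are arbitrary.
_≤m_via_ : Problem → Problem → Rec 1 1 → Set
P ≤m Q via η =
  ∃[ r₋ ] ∃[ r₊ ] ∀ x → IsInstance x → Domain P x →
    ∃[ y ] (IsInstance y × Domain Q y × (η [ code x ∷ [] ]↦ code y)
      × (True (formula P) x ⇔ True (formula Q) y)
      × (∀ α → α ⊩ formula P ⟪ x ⟫ →
           ∃[ β ] ((r₋ [ α ∷ code x ∷ [] ]↦ β) × β ⊩ formula Q ⟪ y ⟫))
      × (∀ α → α ⊩ formula Q ⟪ y ⟫ →
           ∃[ β ] ((r₊ [ α ∷ code x ∷ [] ]↦ β) × β ⊩ formula P ⟪ x ⟫)))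

_≤dm_ : Problem → Problem → Set
P ≤dm Q = ∃[ η ] ((P ≤m Q via η) × (dualP P ≤m dualP Q via η))

_≡dm_ : Problem → Problem → Set
P ≡dm Q = (P ≤dm Q) × (Q ≤dm P)

StrictlyDicomplete : ∀ {Qs k m} → Formula Qs k m → Set
StrictlyDicomplete {Qs} φ =
  ∀ {k m} (ψ : Formula Qs k m) → everywhere ψ ≤dm everywhere φ

Dicomplete : Pattern → Problem → Set
Dicomplete Qs P =
  ∃[ k ] ∃[ m ] Σ[ φ ∈ Formula Qs k m ] (StrictlyDicomplete φ × P ≡dm everywhere φ)

-- A relation (V , E) is given by the characteristic functions of V ⊆ ω and of
-- E ⊆ ω × ω, the latter on coded pairs.  Undirected means symmetric; loops are
-- not excluded.
record IsGraph (V E : Baire) : Set where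
  field
    V-char    : ∀ a → V a ≤ 1
    E-char    : ∀ e → E e ≤ 1
    E⊆V×V     : ∀ a b → E ⟨ a , b ⟩ ≡ 1 → V a ≡ 1 × V b ≡ 1
    symmetric : ∀ a b → E ⟨ a , b ⟩ ≡ 1 → E ⟨ b , a ⟩ ≡ 1

GraphCode : Tuple 0 2 → Set
GraphCode ([] , V ∷ E ∷ []) = IsGraph V E

∈V : ∀ {k} → Term k 2 → Bounded k 2
∈V a = fun 0F a ≐ lit 1

∈E : ∀ {k} → Term k 2 → Term k 2 → Bounded k 2
∈E a b = fun 1F ⟨ a , b ⟩ᵗ ≐ lit 1

-- ∀ a ∃ k ∀ c with matrix
--   a ∈ V → (∀ i ≤ k, cᵢ ∈ V and (a , cᵢ) ∈ E) → ∃ i, j ≤ k, i ≠ j and cᵢ = cⱼ.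
-- Outside the bounded quantifiers, c, k, a are variables 0, 1, 2.
LocFin-formula : Formula (`∀ ∷ `∃ ∷ `∀ ∷ []) 0 2
LocFin-formula = quant `∀ (quant `∃ (quant `∀ (matrix
  (∈V (var 2F)
   ⇒ all≤ (var 1F)
       (∈V (var 1F atᵗ var 0F) ∧ ∈E (var 3F) (var 1F atᵗ var 0F))
   ⇒ ex≤ (var 1F) (ex≤ (var 2F)
       (neg (var 1F ≐ var 0F) ∧ (var 2F atᵗ var 1F) ≐ (var 2F atᵗ var 0F)))))))

LocFin-G : Problem
LocFin-G = record { formula = LocFin-formula ; Domain = GraphCode }

{-# OPTIONS --safe #-}

-- The complete formula is ∀ a ∀∞ t ∀ d. x (a , d) ≤ t, "every row of x is
-- bounded".  A formula ∀ a ∀∞ b ∀ c θ reduces to it through the table whose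
-- entry in row a and column ⟨ b , c ⟩ is 0 if θ holds and b + 1 otherwise: the
-- same bounds serve as witnesses on both sides.
--
-- LocFin-G reduces to its variant with ∀∞ in place of ∃ because "degree ≤ k" is
-- monotone in k.  Conversely, x is mapped to the graph in which vertices
-- ⟨ a , ⟨ i , d ⟩ ⟩ and ⟨ a , ⟨ i′ , d′ ⟩ ⟩ are adjacent if d and d′ are the
-- first columns at which row a reaches i and i′.  A row bounded by t yields at
-- most t + 1 neighbours, one for each i ≤ t, whereas an entry above k yields
-- k + 1 neighbours of the vertex ⟨ a , ⟨ 0 , 0 ⟩ ⟩; so degrees bound the row and
-- not just its number of values.
--
-- All functionals involved are primitive recursive, hence total.  Since a true
-- formula has some witness and a witnessed formula is true, the equivalence of
-- the instances follows from the two translations of witnesses.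

module Submission where

open import Data.Empty using (⊥-elim)
open import Data.Fin using (Fin; zero; suc; toℕ; fromℕ<)
open import Data.Fin.Patterns
open import Data.Fin.Properties using (pigeonhole; toℕ-fromℕ<; toℕ<n)
open import Data.List using ([]; _∷_)
open import Data.Nat
  using (ℕ; zero; suc; _+_; _*_; _∸_; _≤_; _<_; z≤n; s≤s; s≤s⁻¹; pred; _≤?_)
open import Data.Nat.Properties
open import Data.Product using (_×_; _,_; proj₁; proj₂; ∃-syntax)
open import Data.Sum using (_⊎_; inj₁; inj₂; [_,_]′)
open import Data.Unit using (⊤; tt)
open import Data.Vec as Vec using (Vec; []; _∷_; lookup; tabulate)
open import Data.Vec.Relation.Unary.All.Properties using (lookup⁺; lookup⁻)
open import Function using (_∘_; id; mk⇔)
open import Relation.Binary.PropositionalEquality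
  using (_≡_; _≗_; refl; sym; trans; cong; cong₂; cong-app; subst; subst₂;
         module ≡-Reasoning)
open import Relation.Nullary using (¬_; yes; no; contradiction)
open import Defs

-- Uniformly computable families of functions.

private variable
  o n k m : ℕ

-- An index stands for all data in which a program must be uniform, such as an instance and a
-- witness; the program itself sees only the oracles and inputs attached to it.
record Env (o n : ℕ) : Set₁ where
  field
    Index   : Set
    oracles : Index → Vec Baire o
    inputs  : Index → Vec ℕ n

open Env

-- One program serves all indices j, on which f may depend arbitrarily.
record _computes_ (E : Env o n) (f : Index E → ℕ) : Set where
  constructor _by_
  field
    program : Rec o n
    correct : ∀ j → oracles E j ⊢ program · inputs E j ⇓ f j

open _computes_

infix  4 _computes_ _computesᴮ_ _computesᵀ_
infixl 7 _▹

-- The new input comes first, as with de Bruijn indices. A function-valued family thus becomes a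
-- number-valued one with one more input.
_▹ : Env o n → Env o (suc n)
E ▹ = record
  { Index   = Index E × ℕ
  ; oracles = λ (j , _) → oracles E j
  ; inputs  = λ (j , x) → x ∷ inputs E j
  }

_computesᴮ_ : (E : Env o n) → (Index E → Baire) → Set
E computesᴮ F = (E ▹) computes λ (j , i) → F j i

private variable
  E : Env o n

conv : {f g : Index E → ℕ} → f ≗ g → E computes f → E computes g
conv {E = E} eq (p by c) =
  p by λ j → subst (oracles E j ⊢ p · inputs E j ⇓_) (eq j) (c j)

tabulate⇓ : ∀ {Γ : Vec Baire o} {xs : Vec ℕ n} (q : Fin k → Rec o n) (ys : Vec ℕ k) →
            (∀ i → Γ ⊢ q i · xs ⇓ lookup ys i) → Γ ⊢ tabulate q ·* xs ⇓ ys
tabulate⇓ q []       h = []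
tabulate⇓ q (y ∷ ys) h = h zero ∷ tabulate⇓ (q ∘ suc) ys (h ∘ suc)

-- Index `j` of `E′` simulates index `τ j` of `E`. Only inputs are recomputed; the oracles have to
-- agree, so calls to them carry over unchanged.
substitute : {E : Env o n} {E′ : Env o k} {f : Index E → ℕ} (τ : Index E′ → Index E) →
             (∀ j → oracles E′ j ≡ oracles E (τ j)) →
             (∀ i → E′ computes λ j → lookup (inputs E (τ j)) i) →
             E computes f → E′ computes (f ∘ τ)
substitute {E = E} {E′} {f} τ same ins (p by c) =
  comp p (tabulate (program ∘ ins)) by λ j →
    comp⇓ (tabulate⇓ _ _ (λ i → correct (ins i) j))
          (subst (_⊢ p · inputs E (τ j) ⇓ f (τ j)) (sym (same j)) (c (τ j)))

varᶜ : ∀ i → E computes λ j → lookup (inputs E j) i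
varᶜ i = proj i by λ _ → proj⇓

apply : {F : Index E → Baire} {f : Index E → ℕ} →
        E computesᴮ F → E computes f → E computes λ j → F j (f j)
apply {f = f} F g = substitute (λ j → j , f j) (λ _ → refl)
  (λ { zero → g ; (suc i) → varᶜ i }) F

weak : {f : Index E → ℕ} → E computes f → (E ▹) computes (f ∘ proj₁)
weak = substitute proj₁ (λ _ → refl) (varᶜ ∘ suc)

weakᴮ : {F : Index E → Baire} → E computesᴮ F → (E ▹) computesᴮ (F ∘ proj₁)
weakᴮ = substitute (λ ((j , _) , x) → j , x) (λ _ → refl)
  λ { zero → varᶜ 0F ; (suc i) → varᶜ (suc (suc i)) }

oracle : ∀ i → E computesᴮ λ j → lookup (oracles E j) i
oracle i = comp (call i) (proj 0F ∷ []) by λ _ → comp⇓ (proj⇓ ∷ []) call⇓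

-- Primitive recursive arithmetic.

sucᶜ : {f : Index E → ℕ} → E computes f → E computes (suc ∘ f)
sucᶜ (p by c) = comp suc (p ∷ []) by λ j → comp⇓ (c j ∷ []) suc⇓

constᶜ : ∀ c → E computes λ _ → c
constᶜ zero    = zero by λ _ → zero⇓
constᶜ (suc c) = sucᶜ (constᶜ c)

-- The shape of function that `prec` evaluates. Other functions are first rewritten in this form and
-- then transferred by `conv`.
rec : ℕ → (ℕ → ℕ → ℕ) → ℕ → ℕ
rec z s zero    = z
rec z s (suc n) = s n (rec z s n)

recᶜ : {z f : Index E → ℕ} {s : Index E → ℕ → ℕ → ℕ} →
       E computes z → ((E ▹) ▹) computes (λ ((j , u) , x) → s j x u) → E computes f →
       E computes λ j → rec (z j) (s j) (f j)
recᶜ {E = E} {z = z} {s = s} (p by c) (q by d) = apply (prec p q by λ (j , x) → go j x)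
  where
  go : ∀ j x → oracles E j ⊢ prec p q · (x ∷ inputs E j) ⇓ rec (z j) (s j) x
  go j zero    = prec-zero⇓ (c j)
  go j (suc x) = prec-suc⇓ (go j x) (d ((j , _) , x))

module _ {E : Env o n} {f g : Index E → ℕ} where

  _+ᶜ_ : E computes f → E computes g → E computes λ j → f j + g j
  F +ᶜ G = conv (λ j → rec-+ (f j)) (recᶜ G (sucᶜ (varᶜ 1F)) F)
    where
    rec-+ : ∀ {b} a → rec b (λ _ → suc) a ≡ a + b
    rec-+ zero    = refl
    rec-+ (suc a) = cong suc (rec-+ a)

predᶜ : {f : Index E → ℕ} → E computes f → E computes (pred ∘ f)
predᶜ {f = f} F = conv (λ j → rec-pred (f j)) (recᶜ (constᶜ 0) (varᶜ 0F) F)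
  where
  rec-pred : ∀ a → rec 0 (λ x _ → x) a ≡ pred a
  rec-pred zero    = refl
  rec-pred (suc a) = refl

cond : ℕ → ℕ → ℕ → ℕ
cond zero    a b = a
cond (suc _) a b = b

module _ {E : Env o n} {f g : Index E → ℕ} where

  _∸ᶜ_ : E computes f → E computes g → E computes λ j → f j ∸ g j
  F ∸ᶜ G = conv (λ j → rec-∸ (f j) (g j)) (recᶜ F (predᶜ (varᶜ 1F)) G)
    where
    rec-∸ : ∀ a b → rec a (λ _ → pred) b ≡ a ∸ b
    rec-∸ a zero    = refl
    rec-∸ a (suc b) = trans (cong pred (rec-∸ a b)) (pred[m∸n]≡m∸[1+n] a b)

  _*ᶜ_ : E computes f → E computes g → E computes λ j → f j * g j
  F *ᶜ G = conv (λ j → rec-* (f j)) (recᶜ (constᶜ 0) (weak (weak G) +ᶜ varᶜ 1F) F)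
    where
    rec-* : ∀ {b} a → rec 0 (λ _ u → b + u) a ≡ a * b
    rec-* zero    = refl
    rec-* {b} (suc a) = cong (b +_) (rec-* a)

  condᶜ : {h : Index E → ℕ} → E computes h → E computes f → E computes g →
          E computes λ j → cond (h j) (f j) (g j)
  condᶜ {h} H F G = conv (λ j → rec-cond (h j)) (recᶜ F (weak (weak G)) H)
    where
    rec-cond : ∀ {a b} c → rec a (λ _ _ → b) c ≡ cond c a b
    rec-cond zero    = refl
    rec-cond (suc c) = refl

triangleᶜ : {f : Index E → ℕ} → E computes f → E computes (triangle ∘ f)
triangleᶜ {f = f} F =
  conv (λ j → rec-triangle (f j)) (recᶜ (constᶜ 0) (sucᶜ (varᶜ 0F) +ᶜ varᶜ 1F) F)
  where
  rec-triangle : ∀ a → rec 0 (λ x u → suc x + u) a ≡ triangle a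
  rec-triangle zero    = refl
  rec-triangle (suc a) = cong (suc a +_) (rec-triangle a)

⟨_,_⟩ᶜ : {f g : Index E → ℕ} → E computes f → E computes g → E computes λ j → ⟨ f j , g j ⟩
⟨ F , G ⟩ᶜ = G +ᶜ triangleᶜ (F +ᶜ G)

-- Computing the projections of the pairing.

π₁ π₂ : ℕ → ℕ
π₁ = proj₁ ∘ unpair
π₂ = proj₂ ∘ unpair

π₁-⟨,⟩ : ∀ a b → π₁ ⟨ a , b ⟩ ≡ a
π₁-⟨,⟩ a b = cong proj₁ (unpair-⟨,⟩ a b)

π₂-⟨,⟩ : ∀ a b → π₂ ⟨ a , b ⟩ ≡ b
π₂-⟨,⟩ a b = cong proj₂ (unpair-⟨,⟩ a b)

-- The number of the diagonal on which c lies; c moves to the next diagonal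
-- exactly when π₁ c = 0.
diagonal : ℕ → ℕ
diagonal = rec 0 λ c s → s + (1 ∸ ((s + triangle s) ∸ c))

-- If `c` codes `a` and `b`, then `c` is `b + triangle (a + b)`, which falls short of
-- `(a + b) + triangle (a + b)` by exactly `a`.
π₁-from-diagonal : ∀ c → (π₁ c + π₂ c + triangle (π₁ c + π₂ c)) ∸ c ≡ π₁ c
π₁-from-diagonal c with unpair c | ⟨,⟩-unpair c
... | a , b | refl = begin
  (a + b + t) ∸ (b + t) ≡⟨ cong (_∸ (b + t)) (+-assoc a b t) ⟩
  (a + (b + t)) ∸ (b + t) ≡⟨ m+n∸n≡m a (b + t) ⟩
  a ∎
  where open ≡-Reasoning
        t = triangle (a + b)

diagonal-correct : ∀ c → diagonal c ≡ π₁ c + π₂ c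
diagonal-correct zero    = refl
diagonal-correct (suc c) rewrite diagonal-correct c | π₁-from-diagonal c with unpair c
... | suc a , b rewrite 0∸n≡0 a = trans (+-identityʳ (suc a + b)) (sym (+-suc a b))
... | zero  , b = trans (+-comm b 1) (sym (+-identityʳ (suc b)))

module _ {E : Env o n} {f : Index E → ℕ} (F : E computes f) where

  diagonalᶜ : E computes (diagonal ∘ f)
  diagonalᶜ = recᶜ (constᶜ 0)
    (varᶜ 1F +ᶜ (constᶜ 1 ∸ᶜ ((varᶜ 1F +ᶜ triangleᶜ (varᶜ 1F)) ∸ᶜ varᶜ 0F))) F

  π₁ᶜ : E computes (π₁ ∘ f)
  π₁ᶜ = conv (λ j → trans (cong (λ s → s + triangle s ∸ f j) (diagonal-correct (f j)))
                          (π₁-from-diagonal (f j)))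
             ((diagonalᶜ +ᶜ triangleᶜ diagonalᶜ) ∸ᶜ F)

  π₂ᶜ : E computes (π₂ ∘ f)
  π₂ᶜ = conv (λ j → π₂-from-diagonal (f j)) (diagonalᶜ ∸ᶜ π₁ᶜ)
    where
    π₂-from-diagonal : ∀ c → diagonal c ∸ π₁ c ≡ π₂ c
    π₂-from-diagonal c =
      trans (cong (_∸ π₁ c) (diagonal-correct c)) (m+n∸m≡n (π₁ c) (π₂ c))

atᶜ : {f g : Index E → ℕ} → E computes f → E computes g → E computes λ j → f j at g j
atᶜ {f = f} {g} F G =
  conv (λ j → rec-at (f j) (g j)) (π₁ᶜ (recᶜ F (π₂ᶜ (varᶜ 1F)) G))
  where
  drop : ℕ → ℕ → ℕ
  drop c = rec c λ _ → π₂

  drop-suc : ∀ c i → drop c (suc i) ≡ drop (π₂ c) i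
  drop-suc c zero    = refl
  drop-suc c (suc i) = cong π₂ (drop-suc c i)

  rec-at : ∀ c i → π₁ (drop c i) ≡ c at i
  rec-at c zero    = refl
  rec-at c (suc i) = trans (cong π₁ (drop-suc c i)) (rec-at (π₂ c) i)

-- Sequences of functions and interleaving.

unslice : (ℕ → Baire) → Baire
unslice F c = F (π₁ c) (π₂ c)

slice-unslice : ∀ F a → slice (unslice F) a ≗ F a
slice-unslice F a i = cong (λ (x , y) → F x y) (unpair-⟨,⟩ a i)

unsliceᶜ : {F : Index E → ℕ → Baire} →
           (E ▹) computesᴮ (λ (j , a) → F j a) → E computesᴮ (unslice ∘ F)
unsliceᶜ = substitute (λ (j , c) → (j , π₁ c) , π₂ c) (λ _ → refl)
  λ { zero → π₂ᶜ (varᶜ 0F) ; (suc zero) → π₁ᶜ (varᶜ 0F) ; (suc (suc i)) → varᶜ (suc i) }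

cons-cond : ∀ t β i → cond i t (β (pred i)) ≡ cons t β i
cons-cond t β zero    = refl
cons-cond t β (suc i) = refl

consᶜ : {f : Index E → ℕ} {F : Index E → Baire} →
        E computes f → E computesᴮ F → E computesᴮ λ j → cons (f j) (F j)
consᶜ {f = f} {F} G H = conv (λ (j , i) → cons-cond (f j) (F j) i)
  (condᶜ (varᶜ 0F) (weak G) (apply (weakᴮ H) (predᶜ (varᶜ 0F))))

parity half : ℕ → ℕ
parity = rec 0 λ _ u → 1 ∸ u
half   = rec 0 λ n u → u + parity n

parity-01 : ∀ n → parity n ≡ 0 ⊎ parity n ≡ 1
parity-01 zero = inj₁ refl
parity-01 (suc n) with parity n | parity-01 n
... | _ | inj₁ refl = inj₂ refl
... | _ | inj₂ refl = inj₁ refl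

-- Each step of `_⊕_` exchanges the two functions and drops a value of the first, so the induction
-- hypothesis is taken at `g` and `tail f` while the parity flips.
⊕-cond : ∀ f g n → cond (parity n) (f (half n)) (g (half n)) ≡ (f ⊕ g) n
⊕-cond f g zero = refl
⊕-cond f g (suc n) with parity n | parity-01 n | ⊕-cond g (tail f) n
... | _ | inj₁ refl | eq = trans (cong g (+-identityʳ (half n))) eq
... | _ | inj₂ refl | eq = trans (cong f (+-comm (half n) 1)) eq

⊕ᶜ : {F G : Index E → Baire} → E computesᴮ F → E computesᴮ G → E computesᴮ λ j → F j ⊕ G j
⊕ᶜ {F = F} {G} H K = conv (λ (j , i) → ⊕-cond (F j) (G j) i)
  (condᶜ (parityᶜ (varᶜ 0F)) (apply (weakᴮ H) halfᶜ) (apply (weakᴮ K) halfᶜ))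
  where
  parityᶜ : ∀ {o n} {E : Env o n} {f} → E computes f → E computes (parity ∘ f)
  parityᶜ = recᶜ (constᶜ 0) (constᶜ 1 ∸ᶜ varᶜ 1F)
  halfᶜ : (_ ▹) computes λ (_ , i) → half i
  halfᶜ = recᶜ (constᶜ 0) (varᶜ 1F +ᶜ parityᶜ (varᶜ 0F)) (varᶜ 0F)

⊕-even : ∀ f g n → (f ⊕ g) (n + n) ≡ f n
⊕-even f g zero = refl
⊕-even f g (suc n) rewrite +-suc n n = ⊕-even (tail f) (tail g) n

-- Tuples and their codes.

record _computesᵀ_ (E : Env o n) (x : Index E → Tuple k m) : Set where
  field
    number   : ∀ i → E computes λ j → lookup (proj₁ (x j)) i
    function : ∀ i → E computesᴮ λ j → lookup (proj₂ (x j)) i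

open _computesᵀ_

-- The vectors below are functions of an index, so recursion on their length takes them apart by
-- `lookup` and `Vec.tail` instead of by matching; this equation and the next two reconcile the two
-- views.
lookup-tail : ∀ {A : Set} (xs : Vec A (suc n)) i → lookup xs (suc i) ≡ lookup (Vec.tail xs) i
lookup-tail (x ∷ xs) i = refl

join-∷ : ∀ (fs : Vec Baire (2 + m)) → lookup fs 0F ⊕ join (Vec.tail fs) ≗ join fs
join-∷ (f ∷ g ∷ fs) i = refl

code-∷ : ∀ (ns : Vec ℕ (suc k)) (fs : Vec Baire m) →
         cons (lookup ns 0F) (code (Vec.tail ns , fs)) ≗ code (ns , fs)
code-∷ (n ∷ ns) fs i = refl

joinᶜ : ∀ m (fs : Index E → Vec Baire m) → (∀ i → E computesᴮ λ j → lookup (fs j) i) →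
        E computesᴮ (join ∘ fs)
joinᶜ zero fs F = conv (λ (j , _) → join-[] (fs j)) (constᶜ 0)
  where
  join-[] : ∀ (fs : Vec Baire 0) {i} → 0 ≡ join fs i
  join-[] [] = refl
joinᶜ (suc zero) fs F = conv (λ (j , i) → join-singleton (fs j) i) (F 0F)
  where
  join-singleton : ∀ (fs : Vec Baire 1) → lookup fs 0F ≗ join fs
  join-singleton (f ∷ []) i = refl
joinᶜ (suc (suc m)) fs F =
  conv (λ (j , i) → join-∷ (fs j) i)
       (⊕ᶜ (F 0F) (joinᶜ (suc m) (Vec.tail ∘ fs) λ i →
         conv (λ (j , x) → cong-app (lookup-tail (fs j) i) x) (F (suc i))))

code-computable : {x : Index E → Tuple k m} → E computesᵀ x → E computesᴮ (code ∘ x)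
code-computable {E = E} {m = m} {x} c = go _ (proj₁ ∘ x) (number c)
  where
  go : ∀ k (ns : Index E → Vec ℕ k) → (∀ i → E computes λ j → lookup (ns j) i) →
       E computesᴮ λ j → code (ns j , proj₂ (x j))
  go zero ns N =
    conv (λ (j , i) → code-[] (ns j) (proj₂ (x j)) i) (joinᶜ m (proj₂ ∘ x) (function c))
    where
    code-[] : ∀ (ns : Vec ℕ 0) (fs : Vec Baire m) → join fs ≗ code (ns , fs)
    code-[] [] fs i = refl
  go (suc k) ns N =
    conv (λ (j , i) → code-∷ (ns j) (proj₂ (x j)) i)
         (consᶜ (N 0F) (go k (Vec.tail ∘ ns) λ i → conv (λ j → lookup-tail (ns j) i) (N (suc i))))

-- `join` puts the first of several functions at the even places and the joined rest at the odd
-- ones. The last function is not interleaved with anything, whence the case of length one.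
position : Fin m → ℕ → ℕ
position {suc zero}    zero    n = n
position {suc (suc m)} zero    n = n + n
position {suc (suc m)} (suc i) n = suc (position i n + position i n)

join-position : ∀ (fs : Vec Baire m) i n → join fs (position i n) ≡ lookup fs i n
join-position (f ∷ [])     zero    n = refl
join-position (f ∷ g ∷ fs) zero    n = ⊕-even f (join (g ∷ fs)) n
join-position (f ∷ g ∷ fs) (suc i) n =
  trans (⊕-even (join (g ∷ fs)) (tail f) (position i n)) (join-position (g ∷ fs) i n)

code-number : ∀ (x : Tuple k m) i → code x (toℕ i) ≡ lookup (proj₁ x) i
code-number (n ∷ ns , fs) zero    = refl
code-number (n ∷ ns , fs) (suc i) = code-number (ns , fs) i

code-function : ∀ (x : Tuple k m) i → code x (k + i) ≡ join (proj₂ x) i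
code-function ([]     , fs) i = refl
code-function (n ∷ ns , fs) i = code-function (ns , fs) i

-- A program meets an instance only as an oracle for its code; this restores access to the entries,
-- numbers at the first `k` places and functions interleaved after them.
decode-computable : {x : Index E → Tuple k m} → E computesᴮ (code ∘ x) → E computesᵀ x
decode-computable {k = k} {x = x} c = record
  { number   = λ i → conv (λ j → code-number (x j) i) (apply c (constᶜ (toℕ i)))
  ; function = λ i → conv
      (λ (j , n) → trans (code-function (x j) (position i n)) (join-position (proj₂ (x j)) i n))
      (apply (weakᴮ c) (constᶜ k +ᶜ positionᶜ i))
  }
  where
  positionᶜ : ∀ {m} (i : Fin m) → (_ ▹) computes λ (_ , n) → position i n
  positionᶜ {suc zero}    zero    = varᶜ 0F
  positionᶜ {suc (suc m)} zero    = varᶜ 0F +ᶜ varᶜ 0F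
  positionᶜ {suc (suc m)} (suc i) = sucᶜ (positionᶜ i +ᶜ positionᶜ i)

◂-computable : {f : Index E → ℕ} {x : Index E → Tuple k m} →
               E computes f → E computesᵀ x → E computesᵀ λ j → f j ◂ x j
◂-computable F c = record
  { number   = λ { zero → F ; (suc i) → number c i }
  ; function = function c
  }

weakᵀ : {x : Index E → Tuple k m} → E computesᵀ x → (E ▹) computesᵀ (x ∘ proj₁)
weakᵀ c = record { number = weak ∘ number c ; function = weakᴮ ∘ function c }

-- Bounded formulas

-- With 0 for truth, sums act as bounded universal and products as bounded existential quantifiers.
-- Starting from `f 0` makes the upper bound inclusive.
sum≤ prod≤ : Baire → ℕ → ℕ
sum≤  f = rec (f 0) λ i u → u + f (suc i)
prod≤ f = rec (f 0) λ i u → u * f (suc i)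

sum≤≡0⇒ : ∀ f n → sum≤ f n ≡ 0 → ∀ i → i ≤ n → f i ≡ 0
sum≤≡0⇒ f zero eq zero z≤n = eq
sum≤≡0⇒ f (suc n) eq i i≤n with m≤n⇒m<n∨m≡n i≤n
... | inj₁ (s≤s i≤n) = sum≤≡0⇒ f n (m+n≡0⇒m≡0 _ eq) i i≤n
... | inj₂ refl      = m+n≡0⇒n≡0 (sum≤ f n) eq

sum≤≡0⇐ : ∀ f n → (∀ i → i ≤ n → f i ≡ 0) → sum≤ f n ≡ 0
sum≤≡0⇐ f zero    eq = eq 0 z≤n
sum≤≡0⇐ f (suc n) eq =
  cong₂ _+_ (sum≤≡0⇐ f n λ i i≤n → eq i (m≤n⇒m≤1+n i≤n)) (eq (suc n) ≤-refl)

prod≤≡0⇒ : ∀ f n → prod≤ f n ≡ 0 → ∃[ i ] (i ≤ n × f i ≡ 0)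
prod≤≡0⇒ f zero eq = 0 , z≤n , eq
prod≤≡0⇒ f (suc n) eq with m*n≡0⇒m≡0∨n≡0 (prod≤ f n) eq
... | inj₂ eq′ = suc n , ≤-refl , eq′
... | inj₁ eq′ with prod≤≡0⇒ f n eq′
...   | i , i≤n , fi≡0 = i , m≤n⇒m≤1+n i≤n , fi≡0

prod≤≡0⇐ : ∀ f n i → i ≤ n → f i ≡ 0 → prod≤ f n ≡ 0
prod≤≡0⇐ f zero zero z≤n eq = eq
prod≤≡0⇐ f (suc n) i i≤n eq with m≤n⇒m<n∨m≡n i≤n
... | inj₁ (s≤s i≤n) = cong (_* f (suc n)) (prod≤≡0⇐ f n i i≤n eq)
... | inj₂ refl      = trans (cong (prod≤ f n *_) eq) (*-zeroʳ (prod≤ f n))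

-- Truth is represented by the value 0.
χ : Bounded k m → Tuple k m → ℕ
χ (s ≐ t)    x = (⟦ s ⟧ᵗ x ∸ ⟦ t ⟧ᵗ x) + (⟦ t ⟧ᵗ x ∸ ⟦ s ⟧ᵗ x)
χ (s ≼ t)    x = ⟦ s ⟧ᵗ x ∸ ⟦ t ⟧ᵗ x
χ (neg θ)    x = 1 ∸ χ θ x
χ (θ ∧ θ′)   x = χ θ x + χ θ′ x
χ (θ ∨ θ′)   x = χ θ x * χ θ′ x
χ (θ ⇒ θ′)   x = (1 ∸ χ θ x) * χ θ′ x
χ (all≤ t θ) x = sum≤ (λ i → χ θ (i ◂ x)) (⟦ t ⟧ᵗ x)
χ (ex≤ t θ)  x = prod≤ (λ i → χ θ (i ◂ x)) (⟦ t ⟧ᵗ x)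

mutual
  -- Negations and premises of implications reverse the direction, hence the simultaneous induction.
  χ-sound : ∀ (θ : Bounded k m) x → χ θ x ≡ 0 → ⟦ θ ⟧ᵇ x
  χ-sound (s ≐ t) x eq =
    ≤-antisym (m∸n≡0⇒m≤n (m+n≡0⇒m≡0 _ eq))
              (m∸n≡0⇒m≤n (m+n≡0⇒n≡0 (⟦ s ⟧ᵗ x ∸ ⟦ t ⟧ᵗ x) eq))
  χ-sound (s ≼ t) x eq = m∸n≡0⇒m≤n eq
  χ-sound (neg θ) x eq h rewrite χ-complete θ x h = contradiction eq λ ()
  χ-sound (θ ∧ θ′) x eq =
    χ-sound θ x (m+n≡0⇒m≡0 _ eq) , χ-sound θ′ x (m+n≡0⇒n≡0 (χ θ x) eq)
  χ-sound (θ ∨ θ′) x eq =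
    [ inj₁ ∘ χ-sound θ x , inj₂ ∘ χ-sound θ′ x ]′ (m*n≡0⇒m≡0∨n≡0 (χ θ x) eq)
  χ-sound (θ ⇒ θ′) x eq h rewrite χ-complete θ x h =
    χ-sound θ′ x (trans (sym (+-identityʳ _)) eq)
  χ-sound (all≤ t θ) x eq i i≤t =
    χ-sound θ (i ◂ x) (sum≤≡0⇒ (λ i → χ θ (i ◂ x)) (⟦ t ⟧ᵗ x) eq i i≤t)
  χ-sound (ex≤ t θ) x eq with prod≤≡0⇒ (λ i → χ θ (i ◂ x)) (⟦ t ⟧ᵗ x) eq
  ... | i , i≤t , eq′ = i , i≤t , χ-sound θ (i ◂ x) eq′

  χ-complete : ∀ (θ : Bounded k m) x → ⟦ θ ⟧ᵇ x → χ θ x ≡ 0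
  χ-complete (s ≐ t) x eq =
    cong₂ _+_ (m≤n⇒m∸n≡0 (≤-reflexive eq)) (m≤n⇒m∸n≡0 (≤-reflexive (sym eq)))
  χ-complete (s ≼ t) x s≤t = m≤n⇒m∸n≡0 s≤t
  -- The value of `χ` decides `θ`, so no excluded middle is needed.
  χ-complete (neg θ) x h with χ θ x in eq
  ... | zero  = ⊥-elim (h (χ-sound θ x eq))
  ... | suc c = 0∸n≡0 c
  χ-complete (θ ∧ θ′) x (h , h′) = cong₂ _+_ (χ-complete θ x h) (χ-complete θ′ x h′)
  χ-complete (θ ∨ θ′) x (inj₁ h) = cong (_* χ θ′ x) (χ-complete θ x h)
  χ-complete (θ ∨ θ′) x (inj₂ h) =
    trans (cong (χ θ x *_) (χ-complete θ′ x h)) (*-zeroʳ (χ θ x))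
  χ-complete (θ ⇒ θ′) x h with χ θ x in eq
  ... | zero  = trans (+-identityʳ _) (χ-complete θ′ x (h (χ-sound θ x eq)))
  ... | suc c = cong (_* χ θ′ x) (0∸n≡0 c)
  χ-complete (all≤ t θ) x h =
    sum≤≡0⇐ (λ i → χ θ (i ◂ x)) (⟦ t ⟧ᵗ x) λ i i≤t → χ-complete θ (i ◂ x) (h i i≤t)
  χ-complete (ex≤ t θ) x (i , i≤t , h) =
    prod≤≡0⇐ (λ i → χ θ (i ◂ x)) (⟦ t ⟧ᵗ x) i i≤t (χ-complete θ (i ◂ x) h)

module _ {E : Env o n} {F : Index E → Baire} {f : Index E → ℕ}
         (G : E computesᴮ F) (H : E computes f) where

  sum≤ᶜ : E computes λ j → sum≤ (F j) (f j)
  sum≤ᶜ = recᶜ (apply G (constᶜ 0)) (varᶜ 1F +ᶜ apply (weakᴮ (weakᴮ G)) (sucᶜ (varᶜ 0F))) H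

  prod≤ᶜ : E computes λ j → prod≤ (F j) (f j)
  prod≤ᶜ = recᶜ (apply G (constᶜ 0)) (varᶜ 1F *ᶜ apply (weakᴮ (weakᴮ G)) (sucᶜ (varᶜ 0F))) H

termᶜ : {x : Index E → Tuple k m} → E computesᵀ x → ∀ t → E computes λ j → ⟦ t ⟧ᵗ (x j)
termᶜ c (var i)    = number c i
termᶜ c (lit a)    = constᶜ a
termᶜ c (s +ᵗ t)   = termᶜ c s +ᶜ termᶜ c t
termᶜ c (s *ᵗ t)   = termᶜ c s *ᶜ termᶜ c t
termᶜ c ⟨ s , t ⟩ᵗ = ⟨ termᶜ c s , termᶜ c t ⟩ᶜ
termᶜ c (s atᵗ t)  = atᶜ (termᶜ c s) (termᶜ c t)
termᶜ c (fun i t)  = apply (function c i) (termᶜ c t)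

χᶜ : {x : Index E → Tuple k m} → E computesᵀ x → ∀ θ → E computes λ j → χ θ (x j)
χᶜ c (s ≐ t)    = (termᶜ c s ∸ᶜ termᶜ c t) +ᶜ (termᶜ c t ∸ᶜ termᶜ c s)
χᶜ c (s ≼ t)    = termᶜ c s ∸ᶜ termᶜ c t
χᶜ c (neg θ)    = constᶜ 1 ∸ᶜ χᶜ c θ
χᶜ c (θ ∧ θ′)   = χᶜ c θ +ᶜ χᶜ c θ′
χᶜ c (θ ∨ θ′)   = χᶜ c θ *ᶜ χᶜ c θ′
χᶜ c (θ ⇒ θ′)   = (constᶜ 1 ∸ᶜ χᶜ c θ) *ᶜ χᶜ c θ′
χᶜ c (all≤ t θ) = sum≤ᶜ (χᶜ (◂-computable (varᶜ 0F) (weakᵀ c)) θ) (termᶜ c t)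
χᶜ c (ex≤ t θ)  = prod≤ᶜ (χᶜ (◂-computable (varᶜ 0F) (weakᵀ c)) θ) (termᶜ c t)

-- Witnesses

-- Slices of `unslice F` agree with those of `F` only pointwise, so witnesses must be movable along
-- pointwise equality. The choices and thresholds stored in them are moved by `subst`.
⊩-resp-≗ : ∀ {Qs} (φ : Formula Qs k m) {x α β} → α ≗ β → α ⊩ φ ⟪ x ⟫ → β ⊩ φ ⟪ x ⟫
⊩-resp-≗ (matrix θ) α≗β (eq , h) = (λ i → trans (sym (α≗β i)) (eq i)) , h
⊩-resp-≗ (quant `∃ φ) {x} {β = β} α≗β w =
  subst (λ t → tail β ⊩ φ ⟪ t ◂ x ⟫) (α≗β 0) (⊩-resp-≗ φ (α≗β ∘ suc) w)
⊩-resp-≗ (quant `∀ φ) α≗β w n = ⊩-resp-≗ φ (λ i → α≗β ⟨ n , i ⟩) (w n)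
⊩-resp-≗ (quant `∃∞ φ) {x} {β = β} α≗β w n =
  subst (λ t → n ≤ t × tail (slice β n) ⊩ φ ⟪ t ◂ x ⟫) (α≗β ⟨ n , 0 ⟩)
    (proj₁ (w n) , ⊩-resp-≗ φ (λ i → α≗β ⟨ n , suc i ⟩) (proj₂ (w n)))
⊩-resp-≗ (quant `∀∞ φ) {x} {β = β} α≗β w n t≤n =
  ⊩-resp-≗ φ (λ i → α≗β (suc ⟨ n , i ⟩)) (w n (subst (_≤ n) (sym (α≗β 0)) t≤n))

unslice-⊩ : ∀ {Qs} (φ : Formula Qs k m) {x} F a → F a ⊩ φ ⟪ x ⟫ → slice (unslice F) a ⊩ φ ⟪ x ⟫
unslice-⊩ φ F a = ⊩-resp-≗ φ (sym ∘ slice-unslice F a)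

unslice-⊩∞ : ∀ {Qs} (φ : Formula Qs (suc k) m) {x} F →
             (∀ n → n ≤ head (F n) × tail (F n) ⊩ φ ⟪ head (F n) ◂ x ⟫) →
             unslice F ⊩ quant `∃∞ φ ⟪ x ⟫
unslice-⊩∞ φ {x} F w n =
  subst (λ t → n ≤ t × tail (slice (unslice F) n) ⊩ φ ⟪ t ◂ x ⟫)
    (sym (slice-unslice F n 0))
    (proj₁ (w n) , ⊩-resp-≗ φ (sym ∘ slice-unslice F n ∘ suc) (proj₂ (w n)))

⊩-sound : ∀ {Qs} (φ : Formula Qs k m) {x α} → α ⊩ φ ⟪ x ⟫ → True φ x
⊩-sound (matrix θ)    (_ , h)       = h
⊩-sound (quant `∃ φ)  {α = α} w     = head α , ⊩-sound φ w
⊩-sound (quant `∀ φ)  w n           = ⊩-sound φ (w n)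
⊩-sound (quant `∃∞ φ) {α = α} w n   =
  head (slice α n) , proj₁ (w n) , ⊩-sound φ (proj₂ (w n))
⊩-sound (quant `∀∞ φ) {α = α} w     = head α , λ n t≤n → ⊩-sound φ (w n t≤n)

-- A constructive proof of a universal statement is already a choice function, so its values need
-- only be assembled. The witness is not claimed to be computable.
⊩-complete : ∀ {Qs} (φ : Formula Qs k m) {x} → True φ x → ∃[ α ] α ⊩ φ ⟪ x ⟫
⊩-complete (matrix θ) {x} h = code x , (λ _ → refl) , h
⊩-complete (quant `∃ φ) (t , h) with ⊩-complete φ h
... | β , w = cons t β , w
⊩-complete (quant `∀ φ) h =
  unslice (proj₁ ∘ w) , λ n → unslice-⊩ φ (proj₁ ∘ w) n (proj₂ (w n))
  where w = λ n → ⊩-complete φ (h n)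
⊩-complete (quant `∃∞ φ) h =
  unslice F , unslice-⊩∞ φ F λ n → proj₁ (proj₂ (h n)) , proj₂ (⊩-complete φ (proj₂ (proj₂ (h n))))
  where F = λ n → cons (proj₁ (h n)) (proj₁ (⊩-complete φ (proj₂ (proj₂ (h n)))))
⊩-complete (quant `∀∞ φ) {x} (t , h) =
  cons t (unslice F) , λ n t≤n → unslice-⊩ φ F n (F-witness n t≤n)
  where
  F : ℕ → Baire
  F n with t ≤? n
  ... | yes t≤n = proj₁ (⊩-complete φ (h n t≤n))
  -- Below the threshold nothing is required of the slice, so any value will do.
  ... | no  _   = λ _ → 0
  F-witness : ∀ n → t ≤ n → F n ⊩ φ ⟪ n ◂ x ⟫
  F-witness n t≤n with t ≤? n
  ... | yes t≤n′ = proj₂ (⊩-complete φ (h n t≤n′))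
  ... | no  t≰n  = contradiction t≤n t≰n

-- Reductions

open Problem

record Reduction (P Q : Problem)
                 (y : Tuple (nums P) (funs P) → Tuple (nums Q) (funs Q)) : Set₁ where
  field
    forth back : Baire → Tuple (nums P) (funs P) → Baire
    forth-computable : ∀ {o n} {E : Env o n} {α x} → E computesᴮ α → E computesᵀ x →
                       E computesᴮ λ j → forth (α j) (x j)
    back-computable  : ∀ {o n} {E : Env o n} {α x} → E computesᴮ α → E computesᵀ x →
                       E computesᴮ λ j → back (α j) (x j)
    forth-witness : ∀ x α → Domain P x → α ⊩ formula P ⟪ x ⟫ → forth α x ⊩ formula Q ⟪ y x ⟫
    back-witness  : ∀ x α → Domain P x → α ⊩ formula Q ⟪ y x ⟫ → back α x ⊩ formula P ⟪ x ⟫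

-- Computability is demanded relative to every environment, so that reductions
-- compose without composing programs.
record DReduction (P Q : Problem) : Set₁ where
  field
    image      : Tuple (nums P) (funs P) → Tuple (nums Q) (funs Q)
    computable : ∀ {o n} {E : Env o n} {x} → E computesᵀ x → E computesᵀ (image ∘ x)
    domain     : ∀ x → Domain P x → Domain Q (image x)
    primal     : Reduction P Q image
    dualised   : Reduction (dualP P) (dualP Q) image

open Reduction
open DReduction

module _ {P Q R : Problem} {y : Tuple (nums P) (funs P) → Tuple (nums Q) (funs Q)}
         {z : Tuple (nums Q) (funs Q) → Tuple (nums R) (funs R)} where

  reduction-trans : (∀ x → Domain P x → Domain Q (y x)) →
                    (∀ {o n} {E : Env o n} {x} → E computesᵀ x → E computesᵀ (y ∘ x)) →
                    Reduction P Q y → Reduction Q R z → Reduction P R (z ∘ y)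
  reduction-trans dom cmp S T = record
    { forth = λ α x → forth T (forth S α x) (y x)
    ; back  = λ α x → back S (back T α (y x)) x
    ; forth-computable = λ a c → forth-computable T (forth-computable S a c) (cmp c)
    ; back-computable  = λ a c → back-computable S (back-computable T a (cmp c)) c
    ; forth-witness = λ x α d w →
        forth-witness T (y x) _ (dom x d) (forth-witness S x α d w)
    ; back-witness = λ x α d w →
        back-witness S x _ d (back-witness T (y x) α (dom x d) w)
    }

dreduction-trans : ∀ {P Q R} → DReduction P Q → DReduction Q R → DReduction P R
dreduction-trans S T = record
  { image      = image T ∘ image S
  ; computable = λ c → computable T (computable S c)
  ; domain     = λ x d → domain T _ (domain S x d)
  ; primal     = reduction-trans (domain S) (computable S) (primal S) (primal T)
  ; dualised   = reduction-trans (domain S) (computable S) (dualised S) (dualised T)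
  }

-- From reductions to programs.

coded : ∀ k m → Env 1 0
coded k m = record { Index = Tuple k m ; oracles = λ x → code x ∷ [] ; inputs = λ _ → [] }

coded-with-witness : ∀ k m → Env 2 0
coded-with-witness k m = record
  { Index = Baire × Tuple k m ; oracles = λ (α , x) → α ∷ code x ∷ [] ; inputs = λ _ → [] }

closed : Env 0 0
closed = record { Index = ⊤ ; oracles = λ _ → [] ; inputs = λ _ → [] }

instance⇒computable : ∀ {x : Tuple k m} → IsInstance x → closed computesᵀ λ _ → x
instance⇒computable {x = ns , fs} c = record
  { number   = λ i → constᶜ (lookup ns i)
  ; function = λ i → let (p , h) = lookup⁺ c i in p by λ (_ , n) → h n
  }

computable⇒instance : ∀ {x : Tuple k m} → closed computesᵀ (λ _ → x) → IsInstance x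
computable⇒instance c =
  lookup⁻ λ i → program (function c i) , λ n → correct (function c i) (tt , n)

module _ {P Q : Problem} {y : Tuple (nums P) (funs P) → Tuple (nums Q) (funs Q)} where

  -- `η` is an argument so that the primal and the dual reduction share one program.
  reduction⇒≤m : (∀ x → Domain P x → Domain Q (y x)) →
                 (∀ {o n} {E : Env o n} {x} → E computesᵀ x → E computesᵀ (y ∘ x)) →
                 Reduction P Q y → (η : coded (nums P) (funs P) computesᴮ (code ∘ y)) →
                 P ≤m Q via program η
  reduction⇒≤m dom cmp S η = program r₋ , program r₊ , λ x x-inst d →
      y x
    , computable⇒instance (cmp (instance⇒computable x-inst))
    , dom x d
    , (λ n → correct η (x , n))
    , mk⇔ (λ h → let (α , w) = ⊩-complete (formula P) h in
                 ⊩-sound (formula Q) (forth-witness S x α d w))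
          (λ h → let (α , w) = ⊩-complete (formula Q) h in
                 ⊩-sound (formula P) (back-witness S x α d w))
    , (λ α w → forth S α x , (λ n → correct r₋ ((α , x) , n)) , forth-witness S x α d w)
    , (λ α w → back S α x , (λ n → correct r₊ ((α , x) , n)) , back-witness S x α d w)
    where
    r₋ : coded-with-witness (nums P) (funs P) computesᴮ λ (α , x) → forth S α x
    r₋ = forth-computable S (oracle 0F) (decode-computable (oracle 1F))
    r₊ : coded-with-witness (nums P) (funs P) computesᴮ λ (α , x) → back S α x
    r₊ = back-computable S (oracle 0F) (decode-computable (oracle 1F))

dreduction⇒≤dm : ∀ {P Q} → DReduction P Q → P ≤dm Q
dreduction⇒≤dm {P} S =
    program η
  , reduction⇒≤m (domain S) (computable S) (primal S) η
  , reduction⇒≤m (domain S) (computable S) (dualised S) η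
  where
  η : coded (nums P) (funs P) computesᴮ (code ∘ image S)
  η = code-computable (computable S (decode-computable (oracle 0F)))

-- The four quantifier patterns

-- A witness of the matrix must repeat all quantified values, innermost first, before the code of
-- the instance. Only the thresholds and choices matter otherwise, so the functions below rebuild
-- whole witnesses from these.
∀-witness : Baire → Baire
∀-witness X = unslice λ c → cons c X

∀∀∞∀-witness ∀∃∀-witness : Baire → Baire → Baire
∀∀∞∀-witness T X = unslice λ a → cons (T a) (unslice λ b → ∀-witness (cons b (cons a X)))
∀∃∀-witness  T X = unslice λ a → cons (T a) (∀-witness (cons (T a) (cons a X)))

-- The numbers `t n` and `c n` occur twice: as the choices for `∃∞` and `∃`, and then as entries of
-- the tuple at which the matrix is evaluated.
∃∃∞∃-witness : ℕ → Baire → Baire → Baire → Baire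
∃∃∞∃-witness a t c X =
  cons a (unslice λ n → cons (t n) (cons (c n) (cons (c n) (cons (t n) (cons a X)))))

∃∀∃-witness : ℕ → Baire → Baire → Baire
∃∀∃-witness a c X = cons a (unslice λ n → cons (c n) (cons (c n) (cons n (cons a X))))

∀-intro : ∀ (θ : Bounded (suc k) m) x → (∀ c → ⟦ θ ⟧ᵇ (c ◂ x)) →
          ∀-witness (code x) ⊩ quant `∀ (matrix θ) ⟪ x ⟫
∀-intro θ x h c =
  unslice-⊩ (matrix θ) (λ c → cons c (code x)) c ((λ _ → refl) , h c)

module _ (θ : Bounded (3 + k) m) (x : Tuple k m) where

  ∀∀∞∀-intro : ∀ T → (∀ a b c → T a ≤ b → ⟦ θ ⟧ᵇ (c ◂ b ◂ a ◂ x)) →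
               ∀∀∞∀-witness T (code x) ⊩ quant `∀ (quant `∀∞ (quant `∀ (matrix θ))) ⟪ x ⟫
  ∀∀∞∀-intro T h a =
    unslice-⊩ (quant `∀∞ (quant `∀ (matrix θ))) (λ a → cons (T a) (unslice (F a))) a λ b T≤b →
    unslice-⊩ (quant `∀ (matrix θ)) (F a) b
      (∀-intro θ (b ◂ a ◂ x) λ c → h a b c T≤b)
    where F = λ a b → ∀-witness (cons b (cons a (code x)))

  ∀∃∀-intro : ∀ T → (∀ a c → ⟦ θ ⟧ᵇ (c ◂ T a ◂ a ◂ x)) →
              ∀∃∀-witness T (code x) ⊩ quant `∀ (quant `∃ (quant `∀ (matrix θ))) ⟪ x ⟫
  ∀∃∀-intro T h a =
    unslice-⊩ (quant `∃ (quant `∀ (matrix θ)))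
      (λ a → cons (T a) (∀-witness (cons (T a) (cons a (code x))))) a
      (∀-intro θ (T a ◂ a ◂ x) (h a))

  ∃∃∞∃-intro : ∀ a t c → (∀ n → n ≤ t n × ⟦ θ ⟧ᵇ (c n ◂ t n ◂ a ◂ x)) →
               ∃∃∞∃-witness a t c (code x) ⊩ quant `∃ (quant `∃∞ (quant `∃ (matrix θ))) ⟪ x ⟫
  ∃∃∞∃-intro a t c h =
    unslice-⊩∞ (quant `∃ (matrix θ))
      (λ n → cons (t n) (cons (c n) (cons (c n) (cons (t n) (cons a (code x))))))
      λ n → proj₁ (h n) , (λ _ → refl) , proj₂ (h n)

  ∃∀∃-intro : ∀ a c → (∀ n → ⟦ θ ⟧ᵇ (c n ◂ n ◂ a ◂ x)) →
              ∃∀∃-witness a c (code x) ⊩ quant `∃ (quant `∀ (quant `∃ (matrix θ))) ⟪ x ⟫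
  ∃∀∃-intro a c h n =
    unslice-⊩ (quant `∃ (matrix θ))
      (λ n → cons (c n) (cons (c n) (cons n (cons a (code x))))) n ((λ _ → refl) , h n)

∀-witnessᶜ : {X : Index E → Baire} → E computesᴮ X → E computesᴮ λ j → ∀-witness (X j)
∀-witnessᶜ Xᶜ = unsliceᶜ (consᶜ (varᶜ 0F) (weakᴮ Xᶜ))

module _ {E : Env o n} {X : Index E → Baire} (Xᶜ : E computesᴮ X) where

  ∀∀∞∀-witnessᶜ : ∀ {T} → E computesᴮ T → E computesᴮ λ j → ∀∀∞∀-witness (T j) (X j)
  ∀∀∞∀-witnessᶜ Tᶜ = unsliceᶜ (consᶜ Tᶜ (unsliceᶜ
    (∀-witnessᶜ (consᶜ (varᶜ 0F) (consᶜ (varᶜ 1F) (weakᴮ (weakᴮ Xᶜ)))))))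

  ∀∃∀-witnessᶜ : ∀ {T} → E computesᴮ T → E computesᴮ λ j → ∀∃∀-witness (T j) (X j)
  ∀∃∀-witnessᶜ Tᶜ = unsliceᶜ (consᶜ Tᶜ
    (∀-witnessᶜ (consᶜ Tᶜ (consᶜ (varᶜ 0F) (weakᴮ Xᶜ)))))

  ∃∃∞∃-witnessᶜ : ∀ {a t c} → E computes a → E computesᴮ t → E computesᴮ c →
                  E computesᴮ λ j → ∃∃∞∃-witness (a j) (t j) (c j) (X j)
  ∃∃∞∃-witnessᶜ aᶜ tᶜ cᶜ = consᶜ aᶜ (unsliceᶜ (consᶜ tᶜ (consᶜ cᶜ
    (consᶜ cᶜ (consᶜ tᶜ (consᶜ (weak aᶜ) (weakᴮ Xᶜ)))))))

  ∃∀∃-witnessᶜ : ∀ {a c} → E computes a → E computesᴮ c →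
                 E computesᴮ λ j → ∃∀∃-witness (a j) (c j) (X j)
  ∃∀∃-witnessᶜ aᶜ cᶜ = consᶜ aᶜ (unsliceᶜ (consᶜ cᶜ
    (consᶜ cᶜ (consᶜ (varᶜ 0F) (consᶜ (weak aᶜ) (weakᴮ Xᶜ))))))

-- These read the thresholds, or the successive existential choices, from the slices of a witness.
heads seconds : Baire → Baire
heads   α n = head (slice α n)
seconds α n = head (tail (slice α n))

module _ {E : Env o n} {α : Index E → Baire} (A : E computesᴮ α) where

  headᶜ : E computes λ j → head (α j)
  headᶜ = apply A (constᶜ 0)

  tailᶜ : E computesᴮ λ j → tail (α j)
  tailᶜ = apply (weakᴮ A) (sucᶜ (varᶜ 0F))

  headsᶜ : E computesᴮ λ j → heads (α j)
  headsᶜ = apply (weakᴮ A) ⟨ varᶜ 0F , constᶜ 0 ⟩ᶜ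

  secondsᶜ : E computesᴮ λ j → seconds (α j)
  secondsᶜ = apply (weakᴮ A) ⟨ varᶜ 0F , constᶜ 1 ⟩ᶜ

-- The complete formula: all rows of x are bounded

entry≤bound : Bounded 3 1
entry≤bound = fun 0F ⟨ var 2F , var 0F ⟩ᵗ ≼ var 1F

RowsBounded : Formula (`∀ ∷ `∀∞ ∷ `∀ ∷ []) 0 1
RowsBounded = quant `∀ (quant `∀∞ (quant `∀ (matrix entry≤bound)))

module _ (θ : Bounded (3 + k) m) where

  table : Tuple k m → Baire
  table x e = cond (χ θ (π₂ (π₂ e) ◂ π₁ (π₂ e) ◂ π₁ e ◂ x)) 0 (suc (π₁ (π₂ e)))

  module _ (x : Tuple k m) (a d : ℕ) where

    table-row : table x ⟨ a , d ⟩ ≡ cond (χ θ (π₂ d ◂ π₁ d ◂ a ◂ x)) 0 (suc (π₁ d))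
    table-row = cong (λ (a , d) → cond (χ θ (π₂ d ◂ π₁ d ◂ a ◂ x)) 0 (suc (π₁ d)))
                     (unpair-⟨,⟩ a d)

    table≡0 : ⟦ θ ⟧ᵇ (π₂ d ◂ π₁ d ◂ a ◂ x) → table x ⟨ a , d ⟩ ≡ 0
    table≡0 h = trans table-row (cong (λ u → cond u 0 (suc (π₁ d))) (χ-complete θ _ h))

    table≤ : table x ⟨ a , d ⟩ ≤ suc (π₁ d)
    table≤ = subst (_≤ suc (π₁ d)) (sym table-row) (cond≤ (χ θ (π₂ d ◂ π₁ d ◂ a ◂ x)))
      where cond≤ : ∀ u {b} → cond u 0 b ≤ b
            cond≤ zero    = z≤n
            cond≤ (suc u) = ≤-refl

  -- The only value other than 0 is `suc b`, which exceeds `b`.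
  table≤⇒θ : ∀ x a b c → table x ⟨ a , ⟨ b , c ⟩ ⟩ ≤ b → ⟦ θ ⟧ᵇ (c ◂ b ◂ a ◂ x)
  table≤⇒θ x a b c rewrite table-row x a ⟨ b , c ⟩ | unpair-⟨,⟩ b c =
    χ-sound θ _ ∘ cond≤⇒≡0 (χ θ (c ◂ b ◂ a ◂ x))
    where cond≤⇒≡0 : ∀ u → cond u 0 (suc b) ≤ b → u ≡ 0
          cond≤⇒≡0 zero    _   = refl
          cond≤⇒≡0 (suc u) b<b = contradiction b<b (<-irrefl refl)

  table-computable : ∀ {o n} {E : Env o n} {x} → E computesᵀ x → E computesᴮ (table ∘ x)
  table-computable c = condᶜ
    (χᶜ (◂-computable d₂ (◂-computable d₁ (◂-computable (π₁ᶜ (varᶜ 0F)) (weakᵀ c)))) θ)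
    (constᶜ 0) (sucᶜ d₁)
    where d₁ = π₁ᶜ (π₂ᶜ (varᶜ 0F))
          d₂ = π₂ᶜ (π₂ᶜ (varᶜ 0F))

  private
    ψ = quant `∀ (quant `∀∞ (quant `∀ (matrix θ)))

    tabulated : Tuple k m → Tuple 0 1
    tabulated x = [] , table x ∷ []

    tabulated-computable : ∀ {o n} {E : Env o n} {x} →
                           E computesᵀ x → E computesᵀ (tabulated ∘ x)
    tabulated-computable c = record
      { number = λ () ; function = λ { 0F → table-computable c } }

  into-RowsBounded : DReduction (everywhere ψ) (everywhere RowsBounded)
  into-RowsBounded = record
    { image      = tabulated
    ; computable = tabulated-computable
    ; domain     = λ _ _ → tt
    ; primal     = record
      { forth = λ α x → ∀∀∞∀-witness (heads α) (table x)
      ; back  = λ α x → ∀∀∞∀-witness (heads α) (code x)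
      ; forth-computable = λ A c → ∀∀∞∀-witnessᶜ (table-computable c) (headsᶜ A)
      ; back-computable  = λ A c → ∀∀∞∀-witnessᶜ (code-computable c) (headsᶜ A)
      ; forth-witness = λ x α _ w → ∀∀∞∀-intro entry≤bound (tabulated x) (heads α) λ a t d →
          row≤ x a t d (heads α a) λ b c T≤b → proj₂ (w a b T≤b c)
      ; back-witness = λ x α _ w → ∀∀∞∀-intro θ x (heads α) λ a b c T≤b →
          table≤⇒θ x a b c (proj₂ (w a b T≤b ⟨ b , c ⟩))
      }
    ; dualised   = record
      { forth = λ α x →
          let a = head α ; b = heads (tail α) ; c = seconds (tail α) in
          ∃∃∞∃-witness a b (λ n → ⟨ b n , c n ⟩) (table x)
      ; back  = λ α x →
          let a = head α ; d = seconds (tail α) in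
          ∃∃∞∃-witness a (π₁ ∘ d) (π₂ ∘ d) (code x)
      ; forth-computable = λ A c → ∃∃∞∃-witnessᶜ (table-computable c)
          (headᶜ A) (headsᶜ (tailᶜ A)) ⟨ headsᶜ (tailᶜ A) , secondsᶜ (tailᶜ A) ⟩ᶜ
      ; back-computable  = λ A c → ∃∃∞∃-witnessᶜ (code-computable c)
          (headᶜ A) (π₁ᶜ (secondsᶜ (tailᶜ A))) (π₂ᶜ (secondsᶜ (tailᶜ A)))
      ; forth-witness = λ x α _ w →
          let a = head α ; b = heads (tail α) ; c = seconds (tail α) in
          ∃∃∞∃-intro (neg entry≤bound) (tabulated x) a b (λ n → ⟨ b n , c n ⟩) λ n →
            -- A failure of `θ` at `b n` and `c n` leaves an entry above `b n`, so the number chosen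
            -- for `∃∞` can be kept.
            proj₁ (w n) , proj₂ (proj₂ (w n)) ∘ table≤⇒θ x a (b n) (c n)
      ; back-witness = λ x α _ w →
          let a = head α ; t = heads (tail α) ; d = seconds (tail α) in
          ∃∃∞∃-intro (neg θ) x a (π₁ ∘ d) (π₂ ∘ d) λ n →
            large-row x a (d n) n (t n) (proj₁ (w n)) (proj₂ (proj₂ (w n)))
      }
    }
    where
    row≤ : ∀ x a t d T → (∀ b c → T ≤ b → ⟦ θ ⟧ᵇ (c ◂ b ◂ a ◂ x)) → T ≤ t →
           table x ⟨ a , d ⟩ ≤ t
    row≤ x a t d T h T≤t with T ≤? π₁ d
    ... | yes T≤d = subst (_≤ t) (sym (table≡0 x a d (h (π₁ d) (π₂ d) T≤d))) z≤n
    ... | no  T≰d = ≤-trans (table≤ x a d) (≤-trans (≰⇒> T≰d) T≤t)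

    -- An entry above `t` is nonzero, so `θ` fails there; being at most `suc (π₁ d)`, it also forces
    -- `π₁ d` to be at least `t`.
    large-row : ∀ x a d n t → n ≤ t → ¬ table x ⟨ a , d ⟩ ≤ t →
                n ≤ π₁ d × ¬ ⟦ θ ⟧ᵇ (π₂ d ◂ π₁ d ◂ a ◂ x)
    large-row x a d n t n≤t large =
        ≤-trans n≤t (s≤s⁻¹ (≤-trans (≰⇒> large) (table≤ x a d)))
      , λ h → large (subst (_≤ t) (sym (table≡0 x a d h)) z≤n)

RowsBounded-complete : StrictlyDicomplete RowsBounded
RowsBounded-complete (quant `∀ (quant `∀∞ (quant `∀ (matrix θ)))) =
  dreduction⇒≤dm (into-RowsBounded θ)

-- LocFin-G reduces to RowsBounded

body : ∀ {Q₀ Q₁ Q₂} → Formula (Q₀ ∷ Q₁ ∷ Q₂ ∷ []) k m → Bounded (3 + k) m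
body (quant _ (quant _ (quant _ (matrix θ)))) = θ

degree≤ : Bounded 3 2
degree≤ = body LocFin-formula

LocFin∞ : Formula (`∀ ∷ `∀∞ ∷ `∀ ∷ []) 0 2
LocFin∞ = quant `∀ (quant `∀∞ (quant `∀ (matrix degree≤)))

-- The same `c` serves both bounds: a repetition among its first `k + 1` entries is one among its
-- first `l + 1`.
degree≤-mono : ∀ G a k l c → k ≤ l → ⟦ degree≤ ⟧ᵇ (c ◂ k ◂ a ◂ G) → ⟦ degree≤ ⟧ᵇ (c ◂ l ◂ a ◂ G)
degree≤-mono G a k l c k≤l h a∈V adj =
  let (i , i≤k , j , j≤k , eq) = h a∈V λ i i≤k → adj i (≤-trans i≤k k≤l)
  in i , ≤-trans i≤k k≤l , j , ≤-trans j≤k k≤l , eq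

LocFin-G-into-LocFin∞ : DReduction LocFin-G (everywhere LocFin∞)
LocFin-G-into-LocFin∞ = record
  { image      = id
  ; computable = id
  ; domain     = λ _ _ → tt
  ; primal     = record
    { forth = λ α G → ∀∀∞∀-witness (heads α) (code G)
    ; back  = λ α G → ∀∃∀-witness (heads α) (code G)
    ; forth-computable = λ A c → ∀∀∞∀-witnessᶜ (code-computable c) (headsᶜ A)
    ; back-computable  = λ A c → ∀∃∀-witnessᶜ (code-computable c) (headsᶜ A)
    ; forth-witness = λ G α _ w → ∀∀∞∀-intro degree≤ G (heads α) λ a k c h →
        degree≤-mono G a (heads α a) k c h (proj₂ (w a c))
    ; back-witness  = λ G α _ w → ∀∃∀-intro degree≤ G (heads α) λ a c →
        proj₂ (w a (heads α a) ≤-refl c)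
    }
  ; dualised   = record
    { forth = λ α G → ∃∃∞∃-witness (head α) id (heads (tail α)) (code G)
    ; back  = λ α G → ∃∀∃-witness (head α) (seconds (tail α)) (code G)
    ; forth-computable = λ A c →
        ∃∃∞∃-witnessᶜ (code-computable c) (headᶜ A) (varᶜ 0F) (headsᶜ (tailᶜ A))
    ; back-computable  = λ A c →
        ∃∀∃-witnessᶜ (code-computable c) (headᶜ A) (secondsᶜ (tailᶜ A))
    ; forth-witness = λ G α _ w →
        ∃∃∞∃-intro (neg degree≤) G (head α) id (heads (tail α)) λ n →
          ≤-refl , proj₂ (w n)
    ; back-witness  = λ G α _ w →
        -- The witness refutes some bound that is at least `n`; by monotonicity the same tuple
        -- refutes `n`.
        ∃∀∃-intro (neg degree≤) G (head α) (seconds (tail α)) λ n →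
          proj₂ (proj₂ (w n)) ∘
          degree≤-mono G (head α) n (heads (tail α) n) (seconds (tail α) n) (proj₁ (w n))
    }
  }

-- RowsBounded reduces to LocFin-G

-- Bounded minimisation, which stays primitive recursive. If there is no zero up to `n`, the search
-- ends at `n`.
least : Baire → ℕ → ℕ
least f = rec 0 λ n u → cond (f u) u (suc n)

least-≤ : ∀ f n → least f n ≤ n
least-≤ f zero = z≤n
least-≤ f (suc n) with f (least f n)
... | zero  = m≤n⇒m≤1+n (least-≤ f n)
... | suc _ = ≤-refl

least-zero : ∀ f n j → j ≤ n → f j ≡ 0 → f (least f n) ≡ 0 × least f n ≤ j
least-zero f zero zero z≤n eq = eq , z≤n
least-zero f (suc n) j j≤n eq with m≤n⇒m<n∨m≡n j≤n
... | inj₁ (s≤s j≤n) with least-zero f n j j≤n eq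
...   | eq′ , least≤j rewrite eq′ = eq′ , least≤j
least-zero f (suc n) j j≤n eq | inj₂ refl with f (least f n) in eq′
... | zero  = eq′ , m≤n⇒m≤1+n (least-≤ f n)
... | suc _ = eq , ≤-refl

leastᶜ : {F : Index E → Baire} {f : Index E → ℕ} →
         E computesᴮ F → E computes f → E computes λ j → least (F j) (f j)
leastᶜ F G = recᶜ (constᶜ 0)
  (condᶜ (apply (weakᴮ (weakᴮ F)) (varᶜ 1F)) (varᶜ 1F) (sucᶜ (varᶜ 0F))) G

-- The order is descending because the recursion adds each new entry in front.
list-down : Baire → ℕ → ℕ
list-down g = rec 0 λ i u → ⟨ g i , u ⟩

list-down-at : ∀ g n i → i ≤ n → list-down g (suc n) at i ≡ g (n ∸ i)
list-down-at g n zero z≤n = π₁-⟨,⟩ (g n) (list-down g n)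
list-down-at g (suc n) (suc i) (s≤s i≤n) =
  trans (cong (_at i) (π₂-⟨,⟩ (g (suc n)) (list-down g (suc n)))) (list-down-at g n i i≤n)

list-downᶜ : {F : Index E → Baire} {f : Index E → ℕ} →
             E computesᴮ F → E computes f → E computes λ j → list-down (F j) (f j)
list-downᶜ F = recᶜ (constᶜ 0) ⟨ apply (weakᴮ (weakᴮ F)) (varᶜ 0F) , varᶜ 1F ⟩ᶜ

-- The graph of first columns.

vertex : ℕ → ℕ → ℕ → ℕ
vertex a i d = ⟨ a , ⟨ i , d ⟩ ⟩

row rank column : ℕ → ℕ
row    = π₁
rank   = π₁ ∘ π₂
column = π₂ ∘ π₂

hub : ℕ → ℕ
hub a = vertex a 0 0

decompose : ∀ a i d → (row (vertex a i d) , rank (vertex a i d) , column (vertex a i d)) ≡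
            (a , i , d)
decompose a i d rewrite unpair-⟨,⟩ a ⟨ i , d ⟩ | unpair-⟨,⟩ i d = refl

vertex-decomposed : ∀ u → vertex (row u) (rank u) (column u) ≡ u
vertex-decomposed u = trans (cong ⟨ π₁ u ,_⟩ (⟨,⟩-unpair (π₂ u))) (⟨,⟩-unpair u)

-- In the variables d , i , a: column d is the first at which row a reaches i.
first : Bounded 3 1
first = var 1F ≼ fun 0F ⟨ var 2F , var 0F ⟩ᵗ
  ∧ all≤ (var 0F) (var 2F ≼ fun 0F ⟨ var 3F , var 0F ⟩ᵗ ⇒ var 1F ≼ var 0F)

rows : Tuple 0 1 → Baire
rows x = lookup (proj₂ x) 0F

First : Tuple 0 1 → ℕ → ℕ → ℕ → Set
First x a i d = ⟦ first ⟧ᵇ (d ◂ i ◂ a ◂ x)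

first-unique : ∀ x a i d e → First x a i d → First x a i e → d ≡ e
first-unique x a i d e (i≤d , d-least) (i≤e , e-least) with ≤-total d e
... | inj₁ d≤e = ≤-antisym d≤e (e-least d d≤e i≤d)
... | inj₂ e≤d = ≤-antisym (d-least e e≤d i≤e) e≤d

-- The truncated difference vanishes exactly at the columns where the row reaches `i`. If column `d`
-- is one of them, the search up to `d` finds the first.
reach : Tuple 0 1 → ℕ → ℕ → ℕ → ℕ
reach x a d i = least (λ e → i ∸ rows x ⟨ a , e ⟩) d

reach-first : ∀ x a d i → i ≤ rows x ⟨ a , d ⟩ → First x a i (reach x a d i)
reach-first x a d i i≤ =
    m∸n≡0⇒m≤n (proj₁ (least-zero f d d ≤-refl (m≤n⇒m∸n≡0 i≤)))
  , λ e e≤ i≤e → proj₂ (least-zero f d e (≤-trans e≤ (least-≤ f d)) (m≤n⇒m∸n≡0 i≤e))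
  where f = λ e → i ∸ rows x ⟨ a , e ⟩

located : Tuple 0 1 → ℕ → Tuple 3 1
located x u = column u ◂ rank u ◂ row u ◂ x

Good : Tuple 0 1 → ℕ → Set
Good x u = ⟦ first ⟧ᵇ (located x u)

good-vertex : ∀ x a i d → First x a i d → Good x (vertex a i d)
good-vertex x a i d = subst (λ (a , i , d) → First x a i d) (sym (decompose a i d))

-- Every entry reaches 0, so column 0 is the first to do so. Each row thus has a good vertex known
-- in advance, whose degree can be queried.
good-hub : ∀ x a → Good x (hub a)
good-hub x a = good-vertex x a 0 0 (z≤n , λ _ _ _ → z≤n)

-- Uniqueness of the first column makes rank determine a good vertex within its row, so counting
-- neighbours reduces to counting ranks.
good-unique : ∀ x u v → row u ≡ row v → rank u ≡ rank v → Good x u → Good x v → u ≡ v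
good-unique x u v row≡ rank≡ gu gv = begin
  u                                 ≡⟨ vertex-decomposed u ⟨
  vertex (row u) (rank u) (column u) ≡⟨ cong₂ (λ a i → vertex a i (column u)) row≡ rank≡ ⟩
  vertex (row v) (rank v) (column u) ≡⟨ cong (vertex (row v) (rank v)) column≡ ⟩
  vertex (row v) (rank v) (column v) ≡⟨ vertex-decomposed v ⟩
  v                                 ∎
  where
  open ≡-Reasoning
  column≡ : column u ≡ column v
  column≡ = first-unique x (row v) (rank v) (column u) (column v)
    (subst₂ (λ a i → First x a i (column u)) row≡ rank≡ gu) gv

-- The good vertices of a row form a clique, loops included; all other vertices are isolated.
Adjacent : Tuple 0 1 → ℕ → ℕ → Set
Adjacent x u v = row u ≡ row v × Good x u × Good x v

χ-adjacent : Tuple 0 1 → ℕ → ℕ → ℕ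
χ-adjacent x u v =
  ((row u ∸ row v) + (row v ∸ row u)) + (χ first (located x u) + χ first (located x v))

edges : Tuple 0 1 → Baire
edges x e = 1 ∸ χ-adjacent x (π₁ e) (π₂ e)

χ-adjacent-sound : ∀ x u v → χ-adjacent x u v ≡ 0 → Adjacent x u v
χ-adjacent-sound x u v eq =
    ≤-antisym (m∸n≡0⇒m≤n (m+n≡0⇒m≡0 _ same)) (m∸n≡0⇒m≤n (m+n≡0⇒n≡0 (row u ∸ row v) same))
  , χ-sound first (located x u) (m+n≡0⇒m≡0 _ good)
  , χ-sound first (located x v) (m+n≡0⇒n≡0 (χ first (located x u)) good)
  where
  same = m+n≡0⇒m≡0 ((row u ∸ row v) + (row v ∸ row u)) eq
  good = m+n≡0⇒n≡0 ((row u ∸ row v) + (row v ∸ row u)) eq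

χ-adjacent-complete : ∀ x u v → Adjacent x u v → χ-adjacent x u v ≡ 0
χ-adjacent-complete x u v (row≡ , gu , gv) = cong₂ _+_
  (cong₂ _+_ (m≤n⇒m∸n≡0 (≤-reflexive row≡)) (m≤n⇒m∸n≡0 (≤-reflexive (sym row≡))))
  (cong₂ _+_ (χ-complete first (located x u) gu) (χ-complete first (located x v) gv))

edges-⟨,⟩ : ∀ x u v → edges x ⟨ u , v ⟩ ≡ 1 ∸ χ-adjacent x u v
edges-⟨,⟩ x u v = cong (λ (u , v) → 1 ∸ χ-adjacent x u v) (unpair-⟨,⟩ u v)

edges-sound : ∀ x u v → edges x ⟨ u , v ⟩ ≡ 1 → Adjacent x u v
edges-sound x u v eq =
  χ-adjacent-sound x u v (1∸n≡1⇒n≡0 (χ-adjacent x u v) (trans (sym (edges-⟨,⟩ x u v)) eq))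
  where
  1∸n≡1⇒n≡0 : ∀ n → 1 ∸ n ≡ 1 → n ≡ 0
  1∸n≡1⇒n≡0 zero    _ = refl
  1∸n≡1⇒n≡0 (suc n) h = contradiction (trans (sym (0∸n≡0 n)) h) λ ()

edges-complete : ∀ x u v → Adjacent x u v → edges x ⟨ u , v ⟩ ≡ 1
edges-complete x u v adj =
  trans (edges-⟨,⟩ x u v) (cong (1 ∸_) (χ-adjacent-complete x u v adj))

graph : Tuple 0 1 → Tuple 0 2
graph x = [] , (λ _ → 1) ∷ edges x ∷ []

graph-computable : {x : Index E → Tuple 0 1} → E computesᵀ x → E computesᵀ (graph ∘ x)
graph-computable {x = x} c = record
  { number   = λ ()
  ; function = λ
    { 0F → constᶜ 1
    ; 1F → constᶜ 1 ∸ᶜ (((π₁ᶜ u ∸ᶜ π₁ᶜ v) +ᶜ (π₁ᶜ v ∸ᶜ π₁ᶜ u)) +ᶜ (goodᶜ u +ᶜ goodᶜ v))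
    }
  }
  where
  u = π₁ᶜ (varᶜ 0F)
  v = π₂ᶜ (varᶜ 0F)
  goodᶜ : ∀ {f} → (_ ▹) computes f → (_ ▹) computes λ j → χ first (located (x (proj₁ j)) (f j))
  goodᶜ F = χᶜ (◂-computable (π₂ᶜ (π₂ᶜ F)) (◂-computable (π₁ᶜ (π₂ᶜ F))
                 (◂-computable (π₁ᶜ F) (weakᵀ c)))) first

graph-isGraph : ∀ x → GraphCode (graph x)
graph-isGraph x = record
  { V-char    = λ _ → ≤-refl
  ; E-char    = λ e → m∸n≤m 1 (χ-adjacent x (π₁ e) (π₂ e))
  ; E⊆V×V     = λ _ _ _ → refl , refl
  ; symmetric = λ u v uv → let (row≡ , gu , gv) = edges-sound x u v uv in
                           edges-complete x v u (sym row≡ , gv , gu)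
  }

-- Row bounds against degree bounds.

-- The rank of a neighbour is at most the entry in its column, so `k + 1` neighbours share the
-- `n + 1` ranks up to `n`, and two of equal rank coincide. Bounding only the columns named by `c`
-- lets the converse direction search for a large entry among them.
bounded⇒degree≤ : ∀ x u n k c → n < k →
                  (∀ j → j ≤ k → rows x ⟨ row u , column (c at j) ⟩ ≤ n) →
                  ⟦ degree≤ ⟧ᵇ (c ◂ k ◂ u ◂ graph x)
bounded⇒degree≤ x u n k c n<k bounded _ adj =
  let (i , j , i<j , eq) = pigeonhole (s≤s n<k) ranks
      (rowᵢ , _ , goodᵢ) = adjacent i
      (rowⱼ , _ , goodⱼ) = adjacent j
  in toℕ i , s≤s⁻¹ (toℕ<n i) , toℕ j , s≤s⁻¹ (toℕ<n j)
   , <⇒≢ i<j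
   , good-unique x (c at toℕ i) (c at toℕ j) (trans (sym rowᵢ) rowⱼ)
       (trans (sym (toℕ-fromℕ< (rank< i))) (trans (cong toℕ eq) (toℕ-fromℕ< (rank< j))))
       goodᵢ goodⱼ
  where
  adjacent : ∀ (j : Fin (suc k)) → Adjacent x u (c at toℕ j)
  adjacent j = edges-sound x u (c at toℕ j) (proj₂ (adj (toℕ j) (s≤s⁻¹ (toℕ<n j))))
  rank< : ∀ (j : Fin (suc k)) → rank (c at toℕ j) < suc n
  rank< j = let (row≡ , _ , reached , _) = adjacent j in
    s≤s (≤-trans reached
      (subst (λ a → rows x ⟨ a , column (c at toℕ j) ⟩ ≤ n) row≡
        (bounded (toℕ j) (s≤s⁻¹ (toℕ<n j)))))
  ranks : Fin (suc k) → Fin (suc n)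
  ranks j = fromℕ< (rank< j)

clique : Tuple 0 1 → ℕ → ℕ → ℕ → ℕ
clique x a d k = list-down (λ i → vertex a i (reach x a d i)) (suc k)

-- The row reaches every `i` up to `k`, which gives `k + 1` good vertices of distinct ranks. An
-- entry equal to `k` suffices because the hub counts as its own neighbour.
large⇒degree> : ∀ x a d k → k ≤ rows x ⟨ a , d ⟩ →
                ¬ ⟦ degree≤ ⟧ᵇ (clique x a d k ◂ k ◂ hub a ◂ graph x)
large⇒degree> x a d k k≤ h =
  let (i , i≤k , j , j≤k , i≢j , eq) = h refl λ i i≤k → refl , edge i i≤k
  -- Entry `i` of the descending list has rank `k ∸ i`, so equal entries have equal indices.
  in i≢j (∸-cancelˡ-≡ i≤k j≤k (trans (sym (rank-at i i≤k)) (trans (cong rank eq) (rank-at j j≤k))))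
  where
  g : ℕ → ℕ
  g i = vertex a i (reach x a d i)
  rank-at : ∀ i → i ≤ k → rank (clique x a d k at i) ≡ k ∸ i
  rank-at i i≤k = trans (cong rank (list-down-at g k i i≤k))
    (cong (proj₁ ∘ proj₂) (decompose a (k ∸ i) (reach x a d (k ∸ i))))
  edge : ∀ i → i ≤ k → edges x ⟨ hub a , clique x a d k at i ⟩ ≡ 1
  edge i i≤k rewrite list-down-at g k i i≤k = edges-complete x (hub a) (g (k ∸ i))
    ( trans (cong proj₁ (decompose a 0 0))
        (sym (cong proj₁ (decompose a (k ∸ i) (reach x a d (k ∸ i)))))
    , good-hub x a
    , good-vertex x a (k ∸ i) (reach x a d (k ∸ i))
        (reach-first x a d (k ∸ i) (≤-trans (m∸n≤m k i) k≤)))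

-- The search runs through the `n + 2` entries of `c` that bear on degree `suc n`; the tested
-- difference vanishes when the value in the column exceeds `n`.
large-column : Tuple 0 1 → ℕ → ℕ → ℕ → ℕ
large-column x u c n =
  column (c at least (λ j → suc n ∸ rows x ⟨ row u , column (c at j) ⟩) (suc n))

-- If the column found had a value at most `n`, the search would have failed, so every column named
-- by `c` would be bounded by `n` and `c` could not refute the degree bound.
degree>⇒large : ∀ x u c n → ¬ ⟦ degree≤ ⟧ᵇ (c ◂ suc n ◂ u ◂ graph x) →
                ¬ rows x ⟨ row u , large-column x u c n ⟩ ≤ n
degree>⇒large x u c n large small =
  large (bounded⇒degree≤ x u n (suc n) c ≤-refl λ j j≤ → ≮⇒≥ λ n<j →
    <⇒≱ (m∸n≡0⇒m≤n (proj₁ (least-zero f (suc n) j j≤ (m≤n⇒m∸n≡0 n<j)))) small)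
  where f = λ j → suc n ∸ rows x ⟨ row u , column (c at j) ⟩

RowsBounded-into-LocFin-G : DReduction (everywhere RowsBounded) LocFin-G
RowsBounded-into-LocFin-G = record
  { image      = graph
  ; computable = graph-computable
  ; domain     = λ x _ → graph-isGraph x
  ; primal     = record
    -- Values up to `t` allow `t + 1` ranks, hence the successor.
    { forth = λ α x → ∀∃∀-witness (λ u → suc (heads α (row u))) (code (graph x))
    ; back  = λ α x → ∀∀∞∀-witness (λ a → heads α (hub a)) (code x)
    ; forth-computable = λ A c → ∀∃∀-witnessᶜ (code-computable (graph-computable c))
        (sucᶜ (apply (weakᴮ (headsᶜ A)) (π₁ᶜ (varᶜ 0F))))
    ; back-computable  = λ A c → ∀∀∞∀-witnessᶜ (code-computable c)
        (apply (weakᴮ (headsᶜ A)) ⟨ varᶜ 0F , constᶜ 0 ⟩ᶜ)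
    ; forth-witness = λ x α _ w →
        ∀∃∀-intro degree≤ (graph x) (λ u → suc (heads α (row u))) λ u c →
          let n = heads α (row u) in
          bounded⇒degree≤ x u n (suc n) c ≤-refl λ j _ →
            proj₂ (w (row u) n ≤-refl (column (c at j)))
    ; back-witness  = λ x α _ w →
        ∀∀∞∀-intro entry≤bound x (λ a → heads α (hub a)) λ a t d k≤t → ≮⇒≥ λ t<d →
          large⇒degree> x a d (heads α (hub a)) (≤-trans k≤t (<⇒≤ t<d)) (proj₂ (w (hub a) _))
    }
  ; dualised   = record
    { forth = λ α x → let a = head α ; d = seconds (tail α) in
        ∃∀∃-witness (hub a) (λ k → clique x a (d k) k) (code (graph x))
    ; back  = λ α x → let u = head α ; c = heads (tail α) in
        -- An entry above `n` comes from a tuple refuting degree `suc n`, for the same reason as the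
        -- successor in the primal direction.
        ∃∃∞∃-witness (row u) id (λ n → large-column x u (c (suc n)) n) (code x)
    ; forth-computable = λ A c → ∃∀∃-witnessᶜ (code-computable (graph-computable c))
        ⟨ headᶜ A , constᶜ 0 ⟩ᶜ
        (cliqueᶜ (weakᵀ c) (weak (headᶜ A)) (secondsᶜ (tailᶜ A)) (varᶜ 0F))
    ; back-computable  = λ A c → ∃∃∞∃-witnessᶜ (code-computable c)
        (π₁ᶜ (headᶜ A)) (varᶜ 0F)
        (large-columnᶜ (weakᵀ c) (weak (headᶜ A))
          (apply (weakᴮ (headsᶜ (tailᶜ A))) (sucᶜ (varᶜ 0F))) (varᶜ 0F))
    ; forth-witness = λ x α _ w → let a = head α ; d = seconds (tail α) in
        ∃∀∃-intro (neg degree≤) (graph x) (hub a) (λ k → clique x a (d k) k) λ k →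
          -- At stage `k` the witness provides a number at least `k` that the entry in column `d k`
          -- exceeds.
          large⇒degree> x a (d k) k
            (≤-trans (proj₁ (w k)) (<⇒≤ (≰⇒> (proj₂ (proj₂ (w k))))))
    ; back-witness  = λ x α _ w → let u = head α ; c = heads (tail α) in
        ∃∃∞∃-intro (neg entry≤bound) x (row u) id (λ n → large-column x u (c (suc n)) n) λ n →
          ≤-refl , degree>⇒large x u (c (suc n)) n (proj₂ (w (suc n)))
    }
  }
  where
  entryᶜ : ∀ {o n} {E : Env o n} {x a d} → E computesᵀ x → E computes a → E computes d →
           E computes λ j → rows (x j) ⟨ a j , d j ⟩
  entryᶜ c aᶜ dᶜ = apply (function c 0F) ⟨ aᶜ , dᶜ ⟩ᶜ

  cliqueᶜ : ∀ {o n} {E : Env o n} {x a d k} → E computesᵀ x → E computes a → E computes d →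
            E computes k → E computes λ j → clique (x j) (a j) (d j) (k j)
  cliqueᶜ c aᶜ dᶜ kᶜ = list-downᶜ
    ⟨ weak aᶜ , ⟨ varᶜ 0F , leastᶜ
        (varᶜ 1F ∸ᶜ entryᶜ (weakᵀ (weakᵀ c)) (weak (weak aᶜ)) (varᶜ 0F)) (weak dᶜ) ⟩ᶜ ⟩ᶜ
    (sucᶜ kᶜ)

  large-columnᶜ : ∀ {o n} {E : Env o n} {x u c m} → E computesᵀ x → E computes u →
                  E computes c → E computes m →
                  E computes λ j → large-column (x j) (u j) (c j) (m j)
  large-columnᶜ xᶜ uᶜ cᶜ mᶜ = π₂ᶜ (π₂ᶜ (atᶜ cᶜ (leastᶜ
    (sucᶜ (weak mᶜ) ∸ᶜ entryᶜ (weakᵀ xᶜ) (π₁ᶜ (weak uᶜ)) (π₂ᶜ (π₂ᶜ (atᶜ (weak cᶜ) (varᶜ 0F)))))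
    (sucᶜ mᶜ))))

proposition3p3 : Dicomplete (`∀ ∷ `∀∞ ∷ `∀ ∷ []) LocFin-G
proposition3p3 =
    0 , 1 , RowsBounded , RowsBounded-complete
  , dreduction⇒≤dm (dreduction-trans LocFin-G-into-LocFin∞ (into-RowsBounded degree≤))
  , dreduction⇒≤dm RowsBounded-into-LocFin-G
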